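{- Let $\mathscr{A}=\{a_0<a_1<\cdots\}\subseteq\mathbb{N}$ be a sequence. The following are equivalent: (i) $A$ is $O$-regularly varying and has positive increase; (ii) $\displaystyle\int_1^x\frac{A(t)}{t}\,dt=\Theta(A(x))$; (iii) both $A(2x)=O(A(x))$ and $a_{2n}=O(a_n)$; (iv) $\displaystyle\int_1^x\frac{s_{\mathscr{A},h}(t)}{t}\,dt=\Theta(s_{\mathscr{A},h}(x))$ for all or at least some integer $h\geq 1$ (that is, if this holds for at least one $h\ge 1$ then it holds for all $h\geq 1$, and both versions are equivalent to the other conditions).
   Context: $\mathbb{N}$ includes $0$. A sequence is an infinite subset of $\mathbb{N}$, with elements $a_0<a_1<\cdots$ and counting function $A(x)=|\mathscr{A}\cap[0,x]|$. $s_{\mathscr{A},h}(x)$ is the number of ordered $h$-tuples $(k_1,\dots,k_h)\in\mathscr{A}^h$ with $k_1+\cdots+k_h\leq x$. Asymptotic symbols are as $x,n\to+\infty$, and $f\asymp g$ (equivalently $f=\Theta(g)$) means $f=O(g)$ and $g=O(f)$. A positive real function $f$ on some $[x_0,+\infty)$ ($x_0$ may be taken arbitrarily large) is $O$-regularly varying if $f(\lambda x)\asymp f(x)$ for every $\lambda>0$. It is almost increasing if there is $m>0$ with $f(y)\geq m f(x)$ for all $y\geq x\geq x_0$. The lower Matuszewska index is $\mathcal{M}_*(f)=\sup\{\gamma\in\mathbb{R}: x^{ -\gamma}f(x)\text{ is almost increasing}\}$, and $f$ has positive increase if $\mathcal{M}_*(f)>0$. -}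

module Defs where

open import Level using (0ℓ)
open import Algebra.Bundles using (CommutativeRing; Semiring)
open import Axiom.ExcludedMiddle using (ExcludedMiddle)
open import Data.Empty using (⊥-elim)
open import Data.Integer.Base as ℤ using (ℤ; -[1+_])
open import Data.List.Base using (List; []; _∷_; length; filter; upTo; cartesianProductWith)
open import Data.Nat.Base as ℕ using (ℕ; zero; suc)
open import Data.Product.Base using (_×_; _,_; ∃; ∃₂; proj₁; proj₂)
open import Data.Sum.Base using (inj₁; inj₂)
open import Data.Vec.Base as Vec using (Vec)
open import Data.Vec.Relation.Unary.All using (All)
open import Function.Base using (flip)
open import Function.Bundles using (_⇔_)
open import Relation.Binary.Core using (Rel)
open import Relation.Binary.Structures using (IsTotalOrder)
open import Relation.Binary.PropositionalEquality.Core as ≡ using (_≡_)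
open import Relation.Nullary.Decidable.Core using (yes; no)
open import Relation.Nullary.Negation.Core using (¬_)
open import Relation.Nullary.Construct.Add.Extrema using (_±; ⊥±; ⊤±; [_])
open import Relation.Unary using (Pred; _∈_)
import Algebra.Definitions.RawSemiring
import Algebra.Properties.Ring
import Relation.Binary.Construct.Add.Extrema.Strict as Extrema
import Relation.Binary.Construct.NonStrictToStrict as NonStrictToStrict

-- The second-order axioms of the field of real numbers, which determine it up
-- to isomorphism.  `x ⁻¹` is unspecified at x ≈ 0#, and `sup P` is unspecified
-- unless P is inhabited and bounded above.
record CompleteOrderedField : Set₁ where
  infix  8 _⁻¹
  infix  4 _≤_ _≥_
  field
    commutativeRing : CommutativeRing 0ℓ 0ℓ

  open CommutativeRing commutativeRing public

  field
    _≤_          : Rel Carrier 0ℓ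
    isTotalOrder : IsTotalOrder _≈_ _≤_
    0≉1          : ¬ 0# ≈ 1#
    _⁻¹          : Carrier → Carrier
    *-inverseʳ   : ∀ {x} → ¬ x ≈ 0# → x * x ⁻¹ ≈ 1#
    +-monoʳ-≤    : ∀ z {x y} → x ≤ y → z + x ≤ z + y
    *-nonNeg     : ∀ {x y} → 0# ≤ x → 0# ≤ y → 0# ≤ x * y

  _≥_ : Rel Carrier 0ℓ
  _≥_ = flip _≤_

  IsUpperBound : Pred Carrier 0ℓ → Carrier → Set
  IsUpperBound P u = ∀ {x} → x ∈ P → x ≤ u

  IsLowerBound : Pred Carrier 0ℓ → Carrier → Set
  IsLowerBound P l = ∀ {x} → x ∈ P → l ≤ x

  IsLub : Pred Carrier 0ℓ → Carrier → Set
  IsLub P s = IsUpperBound P s × (∀ {u} → IsUpperBound P u → s ≤ u)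

  IsGlb : Pred Carrier 0ℓ → Carrier → Set
  IsGlb P i = IsLowerBound P i × (∀ {l} → IsLowerBound P l → l ≤ i)

  field
    sup       : Pred Carrier 0ℓ → Carrier
    sup-isLub : ∀ {P} → ∃ P → ∃ (IsUpperBound P) → IsLub P (sup P)

-- The range of a is 𝒜, listed in increasing order.
record Enumerates (a : ℕ → ℕ) (𝒜 : Pred ℕ 0ℓ) : Set where
  field
    increasing : ∀ {m n} → m ℕ.< n → a m ℕ.< a n
    range      : ∀ k → k ∈ 𝒜 ⇔ ∃ λ n → a n ≡ k

-- The vectors of length h with all entries below N.
boxes : ∀ h → ℕ → List (Vec ℕ h)
boxes zero    N = Vec.[] ∷ []
boxes (suc h) N = cartesianProductWith Vec._∷_ (upTo N) (boxes h N)

module Analysis (em : ExcludedMiddle 0ℓ) (ℝ : CompleteOrderedField) where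

  open CompleteOrderedField ℝ
  open IsTotalOrder isTotalOrder using (total; antisym; ≤-respˡ-≈; ≤-respʳ-≈)
    renaming (reflexive to ≤-reflexive)
  open Algebra.Definitions.RawSemiring (Semiring.rawSemiring semiring) public using (_^_)
    renaming (_×_ to _·_)
  open NonStrictToStrict _≈_ _≤_ public using (_<_)
  open Extrema _<_ public using (_<±_)

  infixr 8 _^ℤ_ _^ℝ_
  infix  4 _=O_ _=Oₛ_ _=Θ_

  fromℕ : ℕ → Carrier
  fromℕ n = n · 1#

  fromℤ : ℤ → Carrier
  fromℤ (ℤ.+ n)  = fromℕ n
  fromℤ -[1+ n ] = - fromℕ (suc n)

  ∣_∣ : Carrier → Carrier
  ∣ x ∣ with total 0# x
  ... | inj₁ 0≤x = x
  ... | inj₂ x≤0 = - x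

  private
    open Algebra.Properties.Ring ring using (-‿distribˡ-*; -‿involutive)

    0≤1 : 0# ≤ 1#
    0≤1 with total 0# 1#
    ... | inj₁ 0≤1′ = 0≤1′
    ... | inj₂ 1≤0  = ≤-respʳ-≈ [-1]²≈1 (*-nonNeg 0≤-1 0≤-1)
      where
      0≤-1 : 0# ≤ - 1#
      0≤-1 = ≤-respˡ-≈ (-‿inverseˡ 1#) (≤-respʳ-≈ (+-identityʳ (- 1#)) (+-monoʳ-≤ (- 1#) 1≤0))
      [-1]²≈1 : - 1# * - 1# ≈ 1#
      [-1]²≈1 = trans (sym (-‿distribˡ-* 1# (- 1#)))
                      (trans (-‿cong (*-identityˡ (- 1#))) (-‿involutive 1#))

    1≰0 : ¬ 1# ≤ 0#
    1≰0 1≤0 = 0≉1 (antisym 0≤1 1≤0)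

  archimedean : ∀ x → ∃ λ n → x < fromℕ n
  archimedean x with em {∃ λ n → x < fromℕ n}
  ... | yes x<n = x<n
  ... | no  ¬x<n = ⊥-elim (1≰0 1≤0)
    where
    Naturals : Pred Carrier 0ℓ
    Naturals y = ∃ λ n → y ≡ fromℕ n

    n≤x : IsUpperBound Naturals x
    n≤x (n , ≡.refl) with total (fromℕ n) x | em {x ≈ fromℕ n}
    ... | inj₁ n≤x′ | _       = n≤x′
    ... | inj₂ x≤n  | yes x≈n = ≤-reflexive (sym x≈n)
    ... | inj₂ x≤n  | no  x≉n = ⊥-elim (¬x<n (n , x≤n , x≉n))

    s : Carrier
    s = sup Naturals

    s-lub : IsLub Naturals s
    s-lub = sup-isLub (0# , 0 , ≡.refl) (x , n≤x)

    -x+[x+y]≈y : ∀ x y → - x + (x + y) ≈ y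
    -x+[x+y]≈y x y = trans (sym (+-assoc (- x) x y))
                           (trans (+-congʳ (-‿inverseˡ x)) (+-identityˡ y))

    n≤s-1 : IsUpperBound Naturals (- 1# + s)
    n≤s-1 (n , ≡.refl) =
      ≤-respˡ-≈ (-x+[x+y]≈y 1# (fromℕ n)) (+-monoʳ-≤ (- 1#) (proj₁ s-lub (suc n , ≡.refl)))

    0≤-1 : 0# ≤ - 1#
    0≤-1 = ≤-respˡ-≈ (-‿inverseˡ s)
             (≤-respʳ-≈ (trans (+-congˡ (+-comm (- 1#) s)) (-x+[x+y]≈y s (- 1#)))
               (+-monoʳ-≤ (- s) (proj₂ s-lub n≤s-1)))

    1≤0 : 1# ≤ 0#
    1≤0 = ≤-respˡ-≈ (+-identityʳ 1#) (≤-respʳ-≈ (-‿inverseʳ 1#) (+-monoʳ-≤ 1# 0≤-1))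

  -- Real powers of a positive base.  For 1 ≤ x, x ^ℝ γ is the supremum of the
  -- rational powers x^(p/q) with p/q ≤ γ, where "y ≤ x^(p/q)" is expressed by
  -- y^q ≤ x^p to avoid choosing a q-th root; for x < 1, x^γ = 1 / (1/x)^γ.

  _^ℤ_ : Carrier → ℤ → Carrier
  x ^ℤ (ℤ.+ n)  = x ^ n
  x ^ℤ -[1+ n ] = (x ^ suc n) ⁻¹

  BelowRationalPower : Carrier → Carrier → Pred Carrier 0ℓ
  BelowRationalPower x γ y =
    0# ≤ y × ∃₂ λ (p : ℤ) (q : ℕ) →
      1 ℕ.≤ q × fromℤ p ≤ γ * fromℕ q × y ^ q ≤ x ^ℤ p

  _^ℝ_ : Carrier → Carrier → Carrier
  x ^ℝ γ with total 1# x
  ... | inj₁ 1≤x = sup (BelowRationalPower x γ)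
  ... | inj₂ x≤1 = (sup (BelowRationalPower (x ⁻¹) γ)) ⁻¹

  sup± : Pred Carrier 0ℓ → Carrier ±
  sup± P with em {∃ P} | em {∃ (IsUpperBound P)}
  ... | no  _ | _     = ⊥±
  ... | yes _ | no  _ = ⊤±
  ... | yes _ | yes _ = [ sup P ]

  -- Asymptotics as x, n → +∞.

  _=O_ : Rel (Carrier → Carrier) 0ℓ
  f =O g = ∃₂ λ C x₀ → 0# < C × (∀ x → x₀ ≤ x → ∣ f x ∣ ≤ C * ∣ g x ∣)

  _=Oₛ_ : Rel (ℕ → Carrier) 0ℓ
  f =Oₛ g = ∃₂ λ C n₀ → 0# < C × (∀ n → n₀ ℕ.≤ n → ∣ f n ∣ ≤ C * ∣ g n ∣)

  _=Θ_ : Rel (Carrier → Carrier) 0ℓ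
  f =Θ g = f =O g × g =O f

  EventuallyPositive : Pred (Carrier → Carrier) 0ℓ
  EventuallyPositive f = ∃ λ x₀ → ∀ x → x₀ ≤ x → 0# < f x

  ORegularlyVarying : Pred (Carrier → Carrier) 0ℓ
  ORegularlyVarying f =
    EventuallyPositive f × (∀ c → 0# < c → (λ x → f (c * x)) =Θ f)

  AlmostIncreasing : Pred (Carrier → Carrier) 0ℓ
  AlmostIncreasing f = ∃₂ λ m x₀ →
    0# < m × 0# < x₀ × (∀ x y → x₀ ≤ x → x ≤ y → m * f x ≤ f y)

  lowerMatuszewskaIndex : (Carrier → Carrier) → Carrier ±
  lowerMatuszewskaIndex f = sup± λ γ → AlmostIncreasing λ x → x ^ℝ (- γ) * f x

  PositiveIncrease : Pred (Carrier → Carrier) 0ℓ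
  PositiveIncrease f = [ 0# ] <± lowerMatuszewskaIndex f

  -- The Darboux integral.  `StepSum _≤_ f a b` and `StepSum _≥_ f a b` are the
  -- sets of integrals over [a , b] of step functions lying below, respectively
  -- above, f.

  data StepSum (_≾_ : Rel Carrier 0ℓ) (f : Carrier → Carrier) :
               Carrier → Carrier → Pred Carrier 0ℓ where
    nil  : ∀ {a} → StepSum _≾_ f a a 0#
    step : ∀ {a c b v S} → a ≤ c → (∀ t → a ≤ t → t ≤ c → v ≾ f t) →
           StepSum _≾_ f c b S → StepSum _≾_ f a b (v * (c - a) + S)

  IsIntegral : (Carrier → Carrier) → Carrier → Carrier → Carrier → Set
  IsIntegral f a b I = IsLub (StepSum _≤_ f a b) I × IsGlb (StepSum _≥_ f a b) I

  -- ∫₁ˣ f(t)/t dt = Θ(f(x)), including the existence of the integrals.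
  LogIntegralΘ : Pred (Carrier → Carrier) 0ℓ
  LogIntegralΘ f = ∃ λ F →
    (∀ x → 1# ≤ x → IsIntegral (λ t → f t * t ⁻¹) 1# x (F x)) × F =Θ f

  module _ (𝒜 : Pred ℕ 0ℓ) where

    -- All k ≤ x, and all entries of a tuple with sum ≤ x, are below any natural
    -- number exceeding x; this makes the enumerations below finite.

    counting : Carrier → Carrier
    counting x = fromℕ (length (filter (λ k → em {k ∈ 𝒜 × fromℕ k ≤ x})
                                       (upTo (proj₁ (archimedean x)))))

    countingTuples : ℕ → Carrier → Carrier
    countingTuples h x =
      fromℕ (length (filter (λ k → em {All 𝒜 k × fromℕ (Vec.sum k) ≤ x})
                            (boxes h (proj₁ (archimedean x)))))

{-# OPTIONS --safe #-}

-- All four conditions say that the nondecreasing function f at hand (A or s_h)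
-- has regular growth: f(2x) = O(f(x)), and f(Λx) ≥ 2 f(x) eventually for some Λ.
--
-- For the integral F of f(t)/t, regular growth follows from f ≍ F by bounding F
-- over [y , λy] from above with λ close to 1, which gives f(λy) = O(f(y)), and
-- over n dyadic intervals from below, which gives n f(x) ≤ 2 F(2ⁿx).  Conversely,
-- F = O(f) sums a geometric progression over [x/Λ , x], [x/Λ² , x/Λ], …, and
-- f = O(F) needs [x/2 , x] only.  Regular growth is invariant under f ↦ fʰ, and
-- A(x/h)ʰ ≤ s_h(x) ≤ A(x)ʰ; for A it is (iii) because a_m ≤ x iff m < A(x), and
-- (i) because iterating f(Λx) ≥ 2 f(x) yields growth with exponent log 2 / log Λ.

module Submission where

open import Level using (0ℓ)
open import Axiom.ExcludedMiddle using (ExcludedMiddle)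
open import Data.Empty using (⊥-elim)
open import Data.Integer.Base as ℤ using (-[1+_])
open import Data.List.Base using (List; []; _∷_; _++_; length; map; filter; upTo; cartesianProductWith)
import Data.List.Membership.Propositional as List
open import Data.List.Membership.Propositional.Properties
  using (∈-∃++; ∈-++⁺ˡ; ∈-++⁺ʳ; ∈-++⁻; ∈-cartesianProductWith⁺; ∈-cartesianProductWith⁻;
         ∈-upTo⁺; ∈-upTo⁻; ∈-filter⁺; ∈-filter⁻; ∈-map⁺; ∈-map⁻)
import Data.List.Properties as List
import Data.List.Relation.Unary.All as ListAll
import Data.List.Relation.Unary.AllPairs.Core as AllPairs
open import Data.List.Relation.Unary.Any using (here; there)
open import Data.List.Relation.Unary.Unique.Propositional using (Unique)
import Data.List.Relation.Unary.Unique.Propositional.Properties as Unique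
open import Data.Nat.Base as ℕ using (ℕ; zero; suc)
import Data.Nat.Properties as ℕ
open import Data.Product.Base using (_×_; _,_; ∃; ∃₂; proj₁; proj₂)
open import Data.Sum.Base using (_⊎_; inj₁; inj₂)
open import Data.Vec.Base as Vec using (Vec)
import Data.Vec.Properties as Vec
open import Data.Vec.Relation.Unary.All as VecAll using (All)
open import Function.Bundles using (_⇔_; mk⇔; Equivalence)
open import Function.Properties.Equivalence using (⇔-isEquivalence)
open import Relation.Binary.Bundles using (Poset)
open import Relation.Binary.Core using (Rel)
open import Relation.Binary.PropositionalEquality.Core as ≡ using (_≡_)
open import Relation.Binary.Structures using (IsEquivalence; IsTotalOrder)
open import Relation.Nullary.Construct.Add.Extrema using ([_])
open import Relation.Nullary.Decidable.Core using (yes; no)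
open import Relation.Nullary.Negation.Core using (¬_)
open import Relation.Unary using (Pred; _∈_)
import Algebra.Properties.CommutativeSemiring.Exp
import Algebra.Properties.Ring
import Algebra.Properties.Semiring.Exp
import Algebra.Properties.Semiring.Mult
import Algebra.Solver.Ring.NaturalCoefficients.Default
import Relation.Binary.Construct.Add.Extrema.Strict as Extrema
import Relation.Binary.Construct.Add.Supremum.Strict as Supremum
import Relation.Binary.Construct.NonStrictToStrict as NonStrictToStrict
import Relation.Binary.Reasoning.PartialOrder
open import Defs

open IsEquivalence (⇔-isEquivalence {0ℓ}) using () renaming (sym to ⇔-sym; trans to ⇔-trans)

-- Doubling has to be extracted from a relation with `f` on both sides: over [y , λy] the increment
-- of `F` is at most (λ - 1) f(λy), while f(λy) ≤ K F(λy). With λ = 1 + 1/(2K) the increment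
-- accounts for at most half of f(λy) and is absorbed on the left; λ = 2 would leave nothing to
-- conclude for large K. Bernoulli's inequality then reaches the factor 2 by iterating λ. The dyadic
-- lower bound works because every interval [z , 2z] beyond x carries at least f(x)/2, whatever its
-- position. Real powers exist only as suprema of rational approximants, with neither logarithms nor
-- laws of exponents at hand. The exponent log 2 / log Λ is therefore replaced by 1/r with Λ ≤ 2^r,
-- and each estimate of x^(-γ) becomes an inequality between natural powers of approximants.
-- Additivity of the integral is avoided in the same spirit: explicit step functions are extended by
-- one rectangle on the right, and their sums are compared with `F` as a supremum or an infimum.

-- Finite lists, tuples and enumerations

-- Duplicate-free lists serve as finite sets. The search range of a count comes from
-- `archimedean x`, which is not known to be monotone in `x`, so counts are compared through
-- membership and never through their ranges.
Unique-⊆⇒length-≤ : ∀ {X : Set} {xs ys : List X} → Unique xs → (∀ {x} → x List.∈ xs → x List.∈ ys) →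
                    length xs ℕ.≤ length ys
Unique-⊆⇒length-≤ AllPairs.[] xs⊆ys = ℕ.z≤n
Unique-⊆⇒length-≤ {xs = x ∷ xs} (x∉xs AllPairs.∷ uniq) xs⊆ys with ∈-∃++ (xs⊆ys (here ≡.refl))
... | us , vs , ≡.refl = ℕ.≤-trans (ℕ.s≤s (Unique-⊆⇒length-≤ uniq xs⊆us++vs))
                                   (ℕ.≤-reflexive (≡.sym (List.length-++-sucʳ us x vs)))
  where
  xs⊆us++vs : ∀ {y} → y List.∈ xs → y List.∈ us ++ vs
  xs⊆us++vs y∈xs with ∈-++⁻ us (xs⊆ys (there y∈xs))
  ... | inj₁ y∈us         = ∈-++⁺ˡ y∈us
  ... | inj₂ (here ≡.refl) = ⊥-elim (ListAll.lookup x∉xs y∈xs ≡.refl)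
  ... | inj₂ (there y∈vs) = ∈-++⁺ʳ us y∈vs

length-cartesianProductWith : ∀ {X Y Z : Set} (f : X → Y → Z) xs ys →
                              length (cartesianProductWith f xs ys) ≡ length xs ℕ.* length ys
length-cartesianProductWith f []       ys = ≡.refl
length-cartesianProductWith f (x ∷ xs) ys = ≡.trans (List.length-++ (map (f x) ys))
  (≡.cong₂ ℕ._+_ (List.length-map (f x) ys) (length-cartesianProductWith f xs ys))

-- `boxes` over an arbitrary list of entries, so that the same construction also lists the tuples
-- with entries in `elements x`, which are counted by an h-th power.
vectors : ∀ {X : Set} h → List X → List (Vec X h)
vectors zero    xs = Vec.[] ∷ []
vectors (suc h) xs = cartesianProductWith Vec._∷_ xs (vectors h xs)

boxes≡vectors : ∀ h N → boxes h N ≡ vectors h (upTo N)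
boxes≡vectors zero    N = ≡.refl
boxes≡vectors (suc h) N = ≡.cong (cartesianProductWith Vec._∷_ (upTo N)) (boxes≡vectors h N)

module _ {X : Set} (xs : List X) where

  length-vectors : ∀ h → length (vectors h xs) ≡ length xs ℕ.^ h
  length-vectors zero    = ≡.refl
  length-vectors (suc h) = ≡.trans (length-cartesianProductWith Vec._∷_ xs (vectors h xs))
                                   (≡.cong (length xs ℕ.*_) (length-vectors h))

  ∈-vectors⁺ : ∀ {h} {v : Vec X h} → All (List._∈ xs) v → v List.∈ vectors h xs
  ∈-vectors⁺ All.[]       = here ≡.refl
  ∈-vectors⁺ (k∈ All.∷ v∈) = ∈-cartesianProductWith⁺ Vec._∷_ k∈ (∈-vectors⁺ v∈)

  ∈-vectors⁻ : ∀ {h} {v : Vec X h} → v List.∈ vectors h xs → All (List._∈ xs) v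
  ∈-vectors⁻ {zero}  {Vec.[]} _  = All.[]
  ∈-vectors⁻ {suc h}          v∈ with ∈-cartesianProductWith⁻ Vec._∷_ xs (vectors h xs) v∈
  ... | k , w , k∈ , w∈ , ≡.refl = k∈ All.∷ ∈-vectors⁻ w∈

  vectors-unique : ∀ h → Unique xs → Unique (vectors h xs)
  vectors-unique zero    _    = ListAll.[] AllPairs.∷ AllPairs.[]
  vectors-unique (suc h) uniq = Unique.cartesianProductWith⁺ Vec._∷_ Vec.∷-injective uniq (vectors-unique h uniq)

all≤sum : ∀ {h} (v : Vec ℕ h) → All (ℕ._≤ Vec.sum v) v
all≤sum Vec.[]      = All.[]
all≤sum (k Vec.∷ v) = ℕ.m≤m+n k (Vec.sum v) All.∷
  VecAll.map (λ j≤ → ℕ.≤-trans j≤ (ℕ.m≤n+m (Vec.sum v) k)) (all≤sum v)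

module Enumeration {a : ℕ → ℕ} {𝒜} (enum : Enumerates a 𝒜) where
  open Enumerates enum

  a-mono : ∀ {m n} → m ℕ.≤ n → a m ℕ.≤ a n
  a-mono m≤n with ℕ.m≤n⇒m<n∨m≡n m≤n
  ... | inj₁ m<n    = ℕ.<⇒≤ (increasing m<n)
  ... | inj₂ ≡.refl = ℕ.≤-refl

  a-injective : ∀ {m n} → a m ≡ a n → m ≡ n
  a-injective {m} {n} am≡an = ℕ.≤-antisym (ℕ.≮⇒≥ λ n<m → ℕ.<-irrefl (≡.sym am≡an) (increasing n<m))
                                          (ℕ.≮⇒≥ λ m<n → ℕ.<-irrefl am≡an (increasing m<n))

  n≤a[n] : ∀ n → n ℕ.≤ a n
  n≤a[n] zero    = ℕ.z≤n
  n≤a[n] (suc n) = ℕ.≤-<-trans (n≤a[n] n) (increasing (ℕ.n<1+n n))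

module RealAnalysis (em : ExcludedMiddle 0ℓ) (ℝ : CompleteOrderedField) where

  -- Ordered fields

  open CompleteOrderedField ℝ
  open Analysis em ℝ
  open IsTotalOrder isTotalOrder
    using (total; antisym; isPartialOrder; ≤-respˡ-≈; ≤-respʳ-≈)
    renaming (reflexive to ≤-reflexive; refl to ≤-refl; trans to ≤-trans)
  open Algebra.Properties.Ring ring using (-‿involutive; -0#≈0#; -‿distribˡ-*; -‿distribʳ-*)
  open Algebra.Properties.Semiring.Exp semiring using (^-congˡ; ^-assocʳ)
  open Algebra.Properties.Semiring.Mult semiring using (×-homo-+; ×1-homo-*)
  open Algebra.Properties.CommutativeSemiring.Exp commutativeSemiring using (^-distrib-*)

  module Solver = Algebra.Solver.Ring.NaturalCoefficients.Default commutativeSemiring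
  open Solver using (solve; con; _:=_; _:+_; _:*_)

  poset : Poset 0ℓ 0ℓ 0ℓ
  poset = record { isPartialOrder = isPartialOrder }

  module ≤-Reasoning = Relation.Binary.Reasoning.PartialOrder poset
  open ≤-Reasoning
  open NonStrictToStrict _≈_ _≤_ using (<⇒≤)

  <-≤-trans : ∀ {x y z} → x < y → y ≤ z → x < z
  <-≤-trans {x} {y} {z} x<y y≤z = begin-strict x <⟨ x<y ⟩ y ≤⟨ y≤z ⟩ z ∎

  ≤-<-trans : ∀ {x y z} → x ≤ y → y < z → x < z
  ≤-<-trans {x} {y} {z} x≤y y<z = begin-strict x ≤⟨ x≤y ⟩ y <⟨ y<z ⟩ z ∎

  ≤⇒≯ : ∀ {x y} → x ≤ y → ¬ y < x
  ≤⇒≯ x≤y (y≤x , y≉x) = y≉x (antisym y≤x x≤y)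

  ≰⇒> : ∀ {x y} → ¬ x ≤ y → y < x
  ≰⇒> {x} {y} x≰y with total x y
  ... | inj₁ x≤y = ⊥-elim (x≰y x≤y)
  ... | inj₂ y≤x = y≤x , λ y≈x → x≰y (≤-reflexive (sym y≈x))

  ≮⇒≥ : ∀ {x y} → ¬ x < y → y ≤ x
  ≮⇒≥ {x} {y} x≮y with em {y ≤ x}
  ... | yes y≤x = y≤x
  ... | no  y≰x = ⊥-elim (x≮y (≰⇒> y≰x))

  2# : Carrier
  2# = 1# + 1#

  +-mono-≤ : ∀ {x y u v} → x ≤ y → u ≤ v → x + u ≤ y + v
  +-mono-≤ {x} {y} {u} {v} x≤y u≤v = begin
    x + u ≤⟨ +-monoʳ-≤ x u≤v ⟩
    x + v ≈⟨ +-comm x v ⟩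
    v + x ≤⟨ +-monoʳ-≤ v x≤y ⟩
    v + y ≈⟨ +-comm v y ⟩
    y + v ∎

  +-monoˡ-≤ : ∀ z {x y} → x ≤ y → x + z ≤ y + z
  +-monoˡ-≤ z x≤y = +-mono-≤ x≤y ≤-refl

  y+[x-y]≈x : ∀ x y → y + (x - y) ≈ x
  y+[x-y]≈x x y = begin-equality
    y + (x - y)   ≈⟨ solve 3 (λ a b c → a :+ (b :+ c) := b :+ (a :+ c)) refl y x (- y) ⟩
    x + (y - y)   ≈⟨ +-congˡ (-‿inverseʳ y) ⟩
    x + 0#        ≈⟨ +-identityʳ x ⟩
    x             ∎

  x+y≈z⇒z-x≈y : ∀ {x y z} → x + y ≈ z → z - x ≈ y
  x+y≈z⇒z-x≈y {x} {y} {z} x+y≈z = begin-equality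
    z - x        ≈⟨ +-congʳ x+y≈z ⟨
    x + y - x    ≈⟨ +-assoc x y (- x) ⟩
    x + (y - x)  ≈⟨ y+[x-y]≈x y x ⟩
    y            ∎

  +-cancelˡ-≤ : ∀ z {x y} → z + x ≤ z + y → x ≤ y
  +-cancelˡ-≤ z {x} {y} le = begin
    x               ≈⟨ -z+[z+w]≈w x ⟨
    - z + (z + x)   ≤⟨ +-monoʳ-≤ (- z) le ⟩
    - z + (z + y)   ≈⟨ -z+[z+w]≈w y ⟩
    y               ∎
    where
    -z+[z+w]≈w : ∀ w → - z + (z + w) ≈ w
    -z+[z+w]≈w w = trans (sym (+-assoc (- z) z w)) (trans (+-congʳ (-‿inverseˡ z)) (+-identityˡ w))

  +-cancelʳ-≤ : ∀ z {x y} → x + z ≤ y + z → x ≤ y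
  +-cancelʳ-≤ z {x} {y} le = +-cancelˡ-≤ z (≤-respˡ-≈ (+-comm x z) (≤-respʳ-≈ (+-comm y z) le))

  x≤x+y : ∀ x {y} → 0# ≤ y → x ≤ x + y
  x≤x+y x 0≤y = ≤-respˡ-≈ (+-identityʳ x) (+-monoʳ-≤ x 0≤y)

  x≤y+x : ∀ x {y} → 0# ≤ y → x ≤ y + x
  x≤y+x x {y} 0≤y = ≤-respʳ-≈ (+-comm x y) (x≤x+y x 0≤y)

  x≤y⇒0≤y-x : ∀ {x y} → x ≤ y → 0# ≤ y - x
  x≤y⇒0≤y-x {x} {y} x≤y = +-cancelˡ-≤ x (begin
    x + 0#       ≈⟨ +-identityʳ x ⟩
    x            ≤⟨ x≤y ⟩
    y            ≈⟨ y+[x-y]≈x y x ⟨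
    x + (y - x)  ∎)

  +-nonNeg : ∀ {x y} → 0# ≤ x → 0# ≤ y → 0# ≤ x + y
  +-nonNeg {x} 0≤x 0≤y = ≤-trans 0≤x (x≤x+y x 0≤y)

  x≤0⇒0≤-x : ∀ {x} → x ≤ 0# → 0# ≤ - x
  x≤0⇒0≤-x x≤0 = ≤-respʳ-≈ (+-identityˡ _) (x≤y⇒0≤y-x x≤0)

  *-monoʳ-≤ : ∀ {z} → 0# ≤ z → ∀ {x y} → x ≤ y → z * x ≤ z * y
  *-monoʳ-≤ {z} 0≤z {x} {y} x≤y = begin
    z * x                ≤⟨ x≤x+y (z * x) (*-nonNeg 0≤z (x≤y⇒0≤y-x x≤y)) ⟩
    z * x + z * (y - x)  ≈⟨ distribˡ z x (y - x) ⟨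
    z * (x + (y - x))    ≈⟨ *-congˡ (y+[x-y]≈x y x) ⟩
    z * y                ∎

  *-monoˡ-≤ : ∀ {z} → 0# ≤ z → ∀ {x y} → x ≤ y → x * z ≤ y * z
  *-monoˡ-≤ {z} 0≤z {x} {y} x≤y =
    ≤-respˡ-≈ (*-comm z x) (≤-respʳ-≈ (*-comm z y) (*-monoʳ-≤ 0≤z x≤y))

  *-mono-≤ : ∀ {x y u v} → 0# ≤ y → 0# ≤ u → x ≤ y → u ≤ v → x * u ≤ y * v
  *-mono-≤ 0≤y 0≤u x≤y u≤v = ≤-trans (*-monoˡ-≤ 0≤u x≤y) (*-monoʳ-≤ 0≤y u≤v)

  0≤x² : ∀ x → 0# ≤ x * x
  0≤x² x with total 0# x
  ... | inj₁ 0≤x = *-nonNeg 0≤x 0≤x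
  ... | inj₂ x≤0 = ≤-respʳ-≈ (begin-equality
    - x * - x    ≈⟨ -‿distribʳ-* (- x) x ⟨
    - (- x * x)  ≈⟨ -‿cong (*-comm (- x) x) ⟩
    - (x * - x)  ≈⟨ -‿distribʳ-* x (- x) ⟩
    x * - - x    ≈⟨ *-congˡ (-‿involutive x) ⟩
    x * x        ∎) (*-nonNeg (x≤0⇒0≤-x x≤0) (x≤0⇒0≤-x x≤0))

  0≤1 : 0# ≤ 1#
  0≤1 = ≤-respʳ-≈ (*-identityˡ 1#) (0≤x² 1#)

  0<1 : 0# < 1#
  0<1 = 0≤1 , 0≉1

  1≤2 : 1# ≤ 2#
  1≤2 = x≤x+y 1# 0≤1

  1<2 : 1# < 2#
  1<2 = ≰⇒> λ 2≤1 → ≤⇒≯ (+-cancelˡ-≤ 1# (≤-respʳ-≈ (sym (+-identityʳ 1#)) 2≤1)) 0<1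

  0<2 : 0# < 2#
  0<2 = <-≤-trans 0<1 1≤2

  0≤2 : 0# ≤ 2#
  0≤2 = <⇒≤ 0<2

  ≉0 : ∀ {x} → 0# < x → ¬ x ≈ 0#
  ≉0 (_ , 0≉x) x≈0 = 0≉x (sym x≈0)

  *-inverseˡ : ∀ {x} → ¬ x ≈ 0# → x ⁻¹ * x ≈ 1#
  *-inverseˡ {x} x≉0 = trans (*-comm (x ⁻¹) x) (*-inverseʳ x≉0)

  0<x⁻¹ : ∀ {x} → 0# < x → 0# < x ⁻¹
  0<x⁻¹ {x} 0<x = 0≤x⁻¹ , λ 0≈x⁻¹ → 0≉1 (begin-equality
    0#        ≈⟨ zeroʳ x ⟨
    x * 0#    ≈⟨ *-congˡ 0≈x⁻¹ ⟩
    x * x ⁻¹  ≈⟨ *-inverseʳ (≉0 0<x) ⟩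
    1#        ∎)
    where
    0≤x⁻¹ : 0# ≤ x ⁻¹
    0≤x⁻¹ = begin
      0#                    ≤⟨ *-nonNeg (<⇒≤ 0<x) (0≤x² (x ⁻¹)) ⟩
      x * (x ⁻¹ * x ⁻¹)     ≈⟨ *-assoc x (x ⁻¹) (x ⁻¹) ⟨
      (x * x ⁻¹) * x ⁻¹     ≈⟨ *-congʳ (*-inverseʳ (≉0 0<x)) ⟩
      1# * x ⁻¹             ≈⟨ *-identityˡ (x ⁻¹) ⟩
      x ⁻¹                  ∎

  x⁻¹*[x*y]≈y : ∀ {x} → 0# < x → ∀ y → x ⁻¹ * (x * y) ≈ y
  x⁻¹*[x*y]≈y {x} 0<x y = begin-equality
    x ⁻¹ * (x * y)  ≈⟨ *-assoc (x ⁻¹) x y ⟨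
    x ⁻¹ * x * y    ≈⟨ *-congʳ (*-inverseˡ (≉0 0<x)) ⟩
    1# * y          ≈⟨ *-identityˡ y ⟩
    y               ∎

  x*[x⁻¹*y]≈y : ∀ {x} → 0# < x → ∀ y → x * (x ⁻¹ * y) ≈ y
  x*[x⁻¹*y]≈y {x} 0<x y =
    trans (solve 3 (λ a b c → a :* (b :* c) := b :* (a :* c)) refl x (x ⁻¹) y) (x⁻¹*[x*y]≈y 0<x y)

  *-cancelˡ-≤ : ∀ {z} → 0# < z → ∀ {x y} → z * x ≤ z * y → x ≤ y
  *-cancelˡ-≤ {z} 0<z {x} {y} le =
    ≤-respˡ-≈ (x⁻¹*[x*y]≈y 0<z x) (≤-respʳ-≈ (x⁻¹*[x*y]≈y 0<z y) (*-monoʳ-≤ (<⇒≤ (0<x⁻¹ 0<z)) le))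

  *-pos : ∀ {x y} → 0# < x → 0# < y → 0# < x * y
  *-pos {x} {y} 0<x 0<y = ≰⇒> λ xy≤0 → ≤⇒≯ (*-cancelˡ-≤ 0<x (≤-respʳ-≈ (sym (zeroʳ x)) xy≤0)) 0<y

  ⁻¹-antitone : ∀ {x y} → 0# < x → x ≤ y → y ⁻¹ ≤ x ⁻¹
  ⁻¹-antitone {x} {y} 0<x x≤y = *-cancelˡ-≤ 0<y (*-cancelˡ-≤ 0<x (begin
    x * (y * y ⁻¹)   ≈⟨ *-congˡ (*-inverseʳ (≉0 0<y)) ⟩
    x * 1#           ≈⟨ *-identityʳ x ⟩
    x                ≤⟨ x≤y ⟩
    y                ≈⟨ x*[x⁻¹*y]≈y 0<x y ⟨
    x * (x ⁻¹ * y)   ≈⟨ *-congˡ (*-comm (x ⁻¹) y) ⟩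
    x * (y * x ⁻¹)   ∎))
    where
    0<y : 0# < y
    0<y = <-≤-trans 0<x x≤y

  1≤x⇒0<x : ∀ {x} → 1# ≤ x → 0# < x
  1≤x⇒0<x = <-≤-trans 0<1

  1≤x⇒x⁻¹≤1 : ∀ {x} → 1# ≤ x → x ⁻¹ ≤ 1#
  1≤x⇒x⁻¹≤1 {x} 1≤x = begin
    x ⁻¹       ≤⟨ ⁻¹-antitone 0<1 1≤x ⟩
    1# ⁻¹      ≈⟨ *-identityˡ (1# ⁻¹) ⟨
    1# * 1# ⁻¹ ≈⟨ *-inverseʳ (≉0 0<1) ⟩
    1#         ∎

  x≤c*x : ∀ {c x} → 1# ≤ c → 0# ≤ x → x ≤ c * x
  x≤c*x {x = x} 1≤c 0≤x = ≤-respˡ-≈ (*-identityˡ x) (*-monoˡ-≤ 0≤x 1≤c)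

  1≤x*y : ∀ {x y} → 1# ≤ x → 1# ≤ y → 1# ≤ x * y
  1≤x*y 1≤x 1≤y = ≤-trans 1≤y (x≤c*x 1≤x (<⇒≤ (1≤x⇒0<x 1≤y)))

  upperBound₂ : ∀ x y → ∃ λ z → x ≤ z × y ≤ z
  upperBound₂ x y with total x y
  ... | inj₁ x≤y = y , x≤y , ≤-refl
  ... | inj₂ y≤x = x , ≤-refl , y≤x

  -- Otherwise half the excess of `x` over `y`, taken as ε, would be at least the whole excess.
  ≤-from-+ε : ∀ {x y} → (∀ ε → 0# < ε → x ≤ y + ε) → x ≤ y
  ≤-from-+ε {x} {y} x≤y+ε with em {x ≤ y}
  ... | yes x≤y = x≤y
  ... | no  x≰y = ⊥-elim (≤⇒≯ 2d≤d d<2d)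
    where
    d h : Carrier
    d = x - y
    h = 2# ⁻¹ * d
    0<d : 0# < d
    0<d = ≰⇒> λ d≤0 → x≰y (begin
      x          ≈⟨ y+[x-y]≈x x y ⟨
      y + d      ≤⟨ +-monoʳ-≤ y d≤0 ⟩
      y + 0#     ≈⟨ +-identityʳ y ⟩
      y          ∎)
    d≤h : d ≤ h
    d≤h = +-cancelˡ-≤ y (≤-respˡ-≈ (sym (y+[x-y]≈x x y)) (x≤y+ε h (*-pos (0<x⁻¹ 0<2) 0<d)))
    2d≤d : d + d ≤ d
    2d≤d = begin
      d + d           ≤⟨ +-mono-≤ d≤h d≤h ⟩
      h + h           ≈⟨ solve 1 (λ a → a :+ a := con 2 :* a) refl h ⟩
      2# * h          ≈⟨ x*[x⁻¹*y]≈y 0<2 d ⟩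
      d               ∎
    d<2d : d < d + d
    d<2d = ≰⇒> λ le → ≤⇒≯ (+-cancelˡ-≤ d (≤-respʳ-≈ (sym (+-identityʳ d)) le)) 0<d

  fromℕ-nonNeg : ∀ n → 0# ≤ fromℕ n
  fromℕ-nonNeg zero    = ≤-refl
  fromℕ-nonNeg (suc n) = +-nonNeg 0≤1 (fromℕ-nonNeg n)

  fromℕ-mono-≤ : ∀ {m n} → m ℕ.≤ n → fromℕ m ≤ fromℕ n
  fromℕ-mono-≤ {n = n} ℕ.z≤n = fromℕ-nonNeg n
  fromℕ-mono-≤ (ℕ.s≤s m≤n)   = +-monoʳ-≤ 1# (fromℕ-mono-≤ m≤n)

  fromℕ-cancel-≤ : ∀ {m n} → fromℕ m ≤ fromℕ n → m ℕ.≤ n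
  fromℕ-cancel-≤ {zero}          _  = ℕ.z≤n
  fromℕ-cancel-≤ {suc m} {zero}  le = ⊥-elim (≤⇒≯ (≤-trans (x≤x+y 1# (fromℕ-nonNeg m)) le) 0<1)
  fromℕ-cancel-≤ {suc m} {suc n} le = ℕ.s≤s (fromℕ-cancel-≤ (+-cancelˡ-≤ 1# le))

  1≤fromℕ : ∀ {n} → 1 ℕ.≤ n → 1# ≤ fromℕ n
  1≤fromℕ {suc n} _ = x≤x+y 1# (fromℕ-nonNeg n)

  fromℕ-2 : fromℕ 2 ≈ 2#
  fromℕ-2 = +-congˡ (+-identityʳ 1#)

  fromℕ-^ : ∀ m n → fromℕ (m ℕ.^ n) ≈ fromℕ m ^ n
  fromℕ-^ m zero    = +-identityʳ 1#
  fromℕ-^ m (suc n) = trans (×1-homo-* m (m ℕ.^ n)) (*-congˡ (fromℕ-^ m n))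

  ^-nonNeg : ∀ {x} n → 0# ≤ x → 0# ≤ x ^ n
  ^-nonNeg zero    0≤x = 0≤1
  ^-nonNeg (suc n) 0≤x = *-nonNeg 0≤x (^-nonNeg n 0≤x)

  ^-pos : ∀ {x} n → 0# < x → 0# < x ^ n
  ^-pos zero    0<x = 0<1
  ^-pos (suc n) 0<x = *-pos 0<x (^-pos n 0<x)

  1≤^ : ∀ {x} n → 1# ≤ x → 1# ≤ x ^ n
  1≤^ zero    1≤x = ≤-refl
  1≤^ (suc n) 1≤x = 1≤x*y 1≤x (1≤^ n 1≤x)

  ^-monoˡ-≤ : ∀ n {x y} → 0# ≤ x → x ≤ y → x ^ n ≤ y ^ n
  ^-monoˡ-≤ zero    0≤x x≤y = ≤-refl
  ^-monoˡ-≤ (suc n) 0≤x x≤y = *-mono-≤ (≤-trans 0≤x x≤y) (^-nonNeg n 0≤x) x≤y (^-monoˡ-≤ n 0≤x x≤y)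

  ^-monoʳ-≤ : ∀ {x m n} → 1# ≤ x → m ℕ.≤ n → x ^ m ≤ x ^ n
  ^-monoʳ-≤ {n = n} 1≤x ℕ.z≤n     = 1≤^ n 1≤x
  ^-monoʳ-≤         1≤x (ℕ.s≤s le) = *-monoʳ-≤ (<⇒≤ (1≤x⇒0<x 1≤x)) (^-monoʳ-≤ 1≤x le)

  x≤x^n : ∀ {x n} → 1# ≤ x → 1 ℕ.≤ n → x ≤ x ^ n
  x≤x^n {x} 1≤x 1≤n = ≤-respˡ-≈ (*-identityʳ x) (^-monoʳ-≤ 1≤x 1≤n)

  ^-cancelˡ-≤ : ∀ n {x y} → 1 ℕ.≤ n → 0# ≤ x → 0# ≤ y → x ^ n ≤ y ^ n → x ≤ y
  ^-cancelˡ-≤ (suc n) {x} {y} _ 0≤x 0≤y le with em {x ≤ y}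
  ... | yes x≤y = x≤y
  ... | no  x≰y = ⊥-elim (x≰y (*-cancelˡ-≤ (^-pos n 0<x) (begin
    x ^ n * x    ≈⟨ *-comm (x ^ n) x ⟩
    x * x ^ n    ≤⟨ le ⟩
    y * y ^ n    ≤⟨ *-monoʳ-≤ 0≤y (^-monoˡ-≤ n 0≤y (<⇒≤ y<x)) ⟩
    y * x ^ n    ≈⟨ *-comm y (x ^ n) ⟩
    x ^ n * y    ∎)))
    where
    y<x : y < x
    y<x = ≰⇒> x≰y
    0<x : 0# < x
    0<x = ≤-<-trans 0≤y y<x

  1^n≈1 : ∀ n → 1# ^ n ≈ 1#
  1^n≈1 zero    = refl
  1^n≈1 (suc n) = trans (*-identityˡ (1# ^ n)) (1^n≈1 n)

  bernoulli : ∀ {d} → 0# ≤ d → ∀ n → 1# + fromℕ n * d ≤ (1# + d) ^ n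
  bernoulli {d} 0≤d zero    = ≤-reflexive (trans (+-congˡ (zeroˡ d)) (+-identityʳ 1#))
  bernoulli {d} 0≤d (suc n) = begin
    1# + (1# + fromℕ n) * d                   ≤⟨ x≤x+y _ (*-nonNeg 0≤d (*-nonNeg (fromℕ-nonNeg n) 0≤d)) ⟩
    (1# + (1# + fromℕ n) * d) + d * (fromℕ n * d)
      ≈⟨ solve 2 (λ n d → (con 1 :+ (con 1 :+ n) :* d) :+ d :* (n :* d) := (con 1 :+ d) :* (con 1 :+ n :* d)) refl (fromℕ n) d ⟩
    (1# + d) * (1# + fromℕ n * d)             ≤⟨ *-monoʳ-≤ (+-nonNeg 0≤1 0≤d) (bernoulli 0≤d n) ⟩
    (1# + d) * (1# + d) ^ n                   ∎

  n≤2^n : ∀ n → fromℕ n ≤ 2# ^ n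
  n≤2^n n = begin
    fromℕ n                ≈⟨ *-identityʳ (fromℕ n) ⟨
    fromℕ n * 1#           ≤⟨ x≤y+x _ 0≤1 ⟩
    1# + fromℕ n * 1#      ≤⟨ bernoulli 0≤1 n ⟩
    2# ^ n                 ∎

  -- Powers of 2 take the place of logarithms in bounding how many dilations reach a given point.
  ∃2^n≥ : ∀ x → ∃ λ n → x ≤ 2# ^ n
  ∃2^n≥ x with archimedean x
  ... | n , x<n = n , ≤-trans (<⇒≤ x<n) (n≤2^n n)

  ∣x∣≈x : ∀ {x} → 0# ≤ x → ∣ x ∣ ≈ x
  ∣x∣≈x {x} 0≤x with total 0# x
  ... | inj₁ _   = refl
  ... | inj₂ x≤0 = trans (-‿cong x≈0) (trans -0#≈0# (sym x≈0))
    where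
    x≈0 : x ≈ 0#
    x≈0 = antisym x≤0 0≤x

  -- Darboux sums

  -- `StepSum` grows at its left end and is not invariant under `≈`, so a rectangle added on the
  -- right yields a sum `T` that has the expected value only up to `≈`.
  snoc : ∀ {_≾_ : Rel Carrier 0ℓ} {g a b c v S} → StepSum _≾_ g a b S → b ≤ c →
         (∀ t → b ≤ t → t ≤ c → v ≾ g t) → ∃ λ T → StepSum _≾_ g a c T × T ≈ S + v * (c - b)
  snoc nil b≤c v≾g = _ , step b≤c v≾g nil , +-comm _ _
  snoc (step a≤d w≾g s) b≤c v≾g with snoc s b≤c v≾g
  ... | T , s′ , T≈ = _ , step a≤d w≾g s′ , trans (+-congˡ T≈) (sym (+-assoc _ _ _))

  StepSum⇒≤ : ∀ {_≾_ : Rel Carrier 0ℓ} {g a b S} → StepSum _≾_ g a b S → a ≤ b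
  StepSum⇒≤ nil            = ≤-refl
  StepSum⇒≤ (step a≤c _ s) = ≤-trans a≤c (StepSum⇒≤ s)

  v*[c-a]≈0 : ∀ v {a c} → a ≤ c → c ≤ a → v * (c - a) ≈ 0#
  v*[c-a]≈0 v {a} a≤c c≤a = trans (*-congˡ (trans (+-congʳ (antisym c≤a a≤c)) (-‿inverseʳ a))) (zeroʳ v)

  StepSum-degenerate : ∀ {_≾_ : Rel Carrier 0ℓ} {g a b S} → StepSum _≾_ g a b S → b ≤ a → S ≈ 0#
  StepSum-degenerate nil                    b≤a = refl
  StepSum-degenerate (step {v = v} a≤c _ s) b≤a = trans
    (+-cong (v*[c-a]≈0 v a≤c (≤-trans (StepSum⇒≤ s) b≤a)) (StepSum-degenerate s (≤-trans b≤a a≤c)))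
    (+-identityˡ 0#)

  *-interval-+ : ∀ v a d c → v * (d - a) + v * (c - d) ≈ v * (c - a)
  *-interval-+ v a d c = trans (sym (distribˡ v (d - a) (c - d))) (*-congˡ (begin-equality
    (d - a) + (c - d)    ≈⟨ solve 3 (λ d e a → d :+ a :+ e := d :+ e :+ a) refl d (c - d) (- a) ⟩
    d + (c - d) - a      ≈⟨ +-congʳ (y+[x-y]≈x c d) ⟩
    c - a                ∎))

  -- Both step functions are traversed at once; the sum that has advanced further
  -- keeps the value of its current, partially consumed piece [a , c].
  mutual
    lower≤piece+upper : ∀ {g a b c w S T} → StepSum _≤_ g a b S → a ≤ c →
      (∀ t → a ≤ t → t ≤ c → g t ≤ w) → StepSum _≥_ g c b T → S ≤ w * (c - a) + T
    lower≤piece+upper {w = w} nil a≤c g≤w t =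
      ≤-reflexive (sym (trans (+-cong (v*[c-a]≈0 w a≤c (StepSum⇒≤ t)) (StepSum-degenerate t a≤c)) (+-identityˡ 0#)))
    lower≤piece+upper {a = a} {c = c} {w} {T = T} (step {c = d} {v = v} {S} a≤d v≤g s) a≤c g≤w t with total d c
    ... | inj₁ d≤c = begin
      v * (d - a) + S                         ≤⟨ +-mono-≤ (*-monoˡ-≤ (x≤y⇒0≤y-x a≤d) v≤w)
                                                   (lower≤piece+upper s d≤c (λ u d≤u → g≤w u (≤-trans a≤d d≤u)) t) ⟩
      w * (d - a) + (w * (c - d) + T)         ≈⟨ +-assoc _ _ _ ⟨
      w * (d - a) + w * (c - d) + T           ≈⟨ +-congʳ (*-interval-+ w a d c) ⟩
      w * (c - a) + T                         ∎
      where v≤w = ≤-trans (v≤g a ≤-refl a≤d) (g≤w a ≤-refl a≤c)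
    ... | inj₂ c≤d = begin
      v * (d - a) + S                         ≈⟨ +-congʳ (*-interval-+ v a c d) ⟨
      v * (c - a) + v * (d - c) + S           ≈⟨ +-assoc _ _ _ ⟩
      v * (c - a) + (v * (d - c) + S)         ≤⟨ +-mono-≤ (*-monoˡ-≤ (x≤y⇒0≤y-x a≤c) v≤w)
                                                   (piece+lower≤upper s c≤d (λ u c≤u → v≤g u (≤-trans a≤c c≤u)) t) ⟩
      w * (c - a) + T                         ∎
      where v≤w = ≤-trans (v≤g a ≤-refl a≤d) (g≤w a ≤-refl a≤c)

    piece+lower≤upper : ∀ {g a b c v S T} → StepSum _≤_ g c b S → a ≤ c →
      (∀ t → a ≤ t → t ≤ c → v ≤ g t) → StepSum _≥_ g a b T → v * (c - a) + S ≤ T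
    piece+lower≤upper {v = v} s a≤c v≤g nil =
      ≤-reflexive (trans (+-cong (v*[c-a]≈0 v a≤c (StepSum⇒≤ s)) (StepSum-degenerate s a≤c)) (+-identityˡ 0#))
    piece+lower≤upper {a = a} {c = c} {v} {S} s a≤c v≤g (step {c = d} {v = w} {T} a≤d g≤w t) with total d c
    ... | inj₁ d≤c = begin
      v * (c - a) + S                         ≈⟨ +-congʳ (*-interval-+ v a d c) ⟨
      v * (d - a) + v * (c - d) + S           ≈⟨ +-assoc _ _ _ ⟩
      v * (d - a) + (v * (c - d) + S)         ≤⟨ +-mono-≤ (*-monoˡ-≤ (x≤y⇒0≤y-x a≤d) v≤w)
                                                   (piece+lower≤upper s d≤c (λ u d≤u → v≤g u (≤-trans a≤d d≤u)) t) ⟩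
      w * (d - a) + T                         ∎
      where v≤w = ≤-trans (v≤g a ≤-refl a≤c) (g≤w a ≤-refl a≤d)
    ... | inj₂ c≤d = begin
      v * (c - a) + S                         ≤⟨ +-mono-≤ (*-monoˡ-≤ (x≤y⇒0≤y-x a≤c) v≤w)
                                                   (lower≤piece+upper s c≤d (λ u c≤u → g≤w u (≤-trans a≤c c≤u)) t) ⟩
      w * (c - a) + (w * (d - c) + T)         ≈⟨ +-assoc _ _ _ ⟨
      w * (c - a) + w * (d - c) + T           ≈⟨ +-congʳ (*-interval-+ w a c d) ⟩
      w * (d - a) + T                         ∎
      where v≤w = ≤-trans (v≤g a ≤-refl a≤c) (g≤w a ≤-refl a≤d)

  lower≤upper : ∀ {g a b S T} → StepSum _≤_ g a b S → StepSum _≥_ g a b T → S ≤ T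
  lower≤upper nil               t = ≤-reflexive (sym (StepSum-degenerate t ≤-refl))
  lower≤upper (step a≤c v≤g s) t = piece+lower≤upper s a≤c v≤g t

  -- The supremum of the lower sums exceeds no upper sum, and an upper sum within ε of some lower
  -- sum is at most ε above it; hence it is also the infimum of the upper sums.
  darboux-criterion : ∀ {g a b} → (∀ ε → 0# < ε → ∃₂ λ S T → StepSum _≤_ g a b S × StepSum _≥_ g a b T × T ≤ S + ε) →
               IsIntegral g a b (sup (StepSum _≤_ g a b))
  darboux-criterion {g} {a} {b} gap with gap 1# 0<1
  ... | S , T , s , t , _ = lub , (λ u → proj₂ lub (λ l → lower≤upper l u)) , greatest
    where
    I : Carrier
    I = sup (StepSum _≤_ g a b)

    lub : IsLub (StepSum _≤_ g a b) I
    lub = sup-isLub (S , s) (T , λ l → lower≤upper l t)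

    greatest : ∀ {l} → IsLowerBound (StepSum _≥_ g a b) l → l ≤ I
    greatest {l} l≤ = ≤-from-+ε λ ε 0<ε → let S′ , T′ , s′ , t′ , T′≤S′+ε = gap ε 0<ε in begin
      l        ≤⟨ l≤ t′ ⟩
      T′       ≤⟨ T′≤S′+ε ⟩
      S′ + ε   ≤⟨ +-monoˡ-≤ ε (proj₁ lub s′) ⟩
      I + ε    ∎

  Monotone : (Carrier → Carrier) → Set
  Monotone f = ∀ {x y} → x ≤ y → f x ≤ f y

  Nonnegative : (Carrier → Carrier) → Set
  Nonnegative f = ∀ x → 0# ≤ f x

  -- Integrability of f(t)/t for nondecreasing f

  module LogIntegrand (f : Carrier → Carrier) (f-mono : Monotone f) (f-nonNeg : Nonnegative f) where

    g : Carrier → Carrier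
    g t = f t * t ⁻¹

    g-upper : ∀ {a c} → 1# ≤ a → ∀ t → a ≤ t → t ≤ c → g t ≤ f c * a ⁻¹
    g-upper 1≤a t a≤t t≤c = *-mono-≤ (f-nonNeg _) (<⇒≤ (0<x⁻¹ (1≤x⇒0<x (≤-trans 1≤a a≤t)))) (f-mono t≤c)
                              (⁻¹-antitone (1≤x⇒0<x 1≤a) a≤t)

    g-lower : ∀ {a c} → 1# ≤ a → ∀ t → a ≤ t → t ≤ c → f a * c ⁻¹ ≤ g t
    g-lower 1≤a t a≤t t≤c =
      *-mono-≤ (f-nonNeg _) (<⇒≤ (0<x⁻¹ (1≤x⇒0<x (≤-trans 1≤a (≤-trans a≤t t≤c))))) (f-mono a≤t)
        (⁻¹-antitone (1≤x⇒0<x (≤-trans 1≤a a≤t)) t≤c)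

    -- On a piece [a , c] of length δ the upper and lower sums differ by at most
    -- δ (f c - f a) + δ M (a⁻¹ - c⁻¹), and these bounds telescope.
    piece-gap : ∀ {M a c δ} → 0# ≤ δ → 1# ≤ a → a ≤ c → f a ≤ M →
                f c * a ⁻¹ * δ + (f a * δ + M * c ⁻¹ * δ) ≤ f a * c ⁻¹ * δ + (f c * δ + M * a ⁻¹ * δ)
    piece-gap {M} {a} {c} {δ} 0≤δ 1≤a a≤c fa≤M = begin
      f c * a ⁻¹ * δ + (f a * δ + M * c ⁻¹ * δ)
        ≈⟨ +-cong (*-congʳ (*-congʳ (y+[x-y]≈x (f c) (f a)))) (+-congˡ (*-congʳ (*-congʳ (y+[x-y]≈x M (f a))))) ⟨
      (f a + e) * a ⁻¹ * δ + (f a * δ + (f a + d) * c ⁻¹ * δ)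
        ≈⟨ solve 6 (λ p e d r s δ → (p :+ e) :* r :* δ :+ (p :* δ :+ (p :+ d) :* s :* δ)
             := ((p :* r :+ p :+ p :* s) :+ (e :* r :+ d :* s)) :* δ) refl (f a) e d (a ⁻¹) (c ⁻¹) δ ⟩
      ((f a * a ⁻¹ + f a + f a * c ⁻¹) + (e * a ⁻¹ + d * c ⁻¹)) * δ
        ≤⟨ *-monoˡ-≤ 0≤δ (+-monoʳ-≤ _ (+-mono-≤ (*-monoʳ-≤ (x≤y⇒0≤y-x (f-mono a≤c)) (1≤x⇒x⁻¹≤1 1≤a))
                                                (*-monoʳ-≤ (x≤y⇒0≤y-x fa≤M) (⁻¹-antitone (1≤x⇒0<x 1≤a) a≤c)))) ⟩
      ((f a * a ⁻¹ + f a + f a * c ⁻¹) + (e * 1# + d * a ⁻¹)) * δ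
        ≈⟨ solve 6 (λ p e d r s δ → ((p :* r :+ p :+ p :* s) :+ (e :* con 1 :+ d :* r)) :* δ
             := p :* s :* δ :+ ((p :+ e) :* δ :+ (p :+ d) :* r :* δ)) refl (f a) e d (a ⁻¹) (c ⁻¹) δ ⟩
      f a * c ⁻¹ * δ + ((f a + e) * δ + (f a + d) * a ⁻¹ * δ)
        ≈⟨ +-congˡ (+-cong (*-congʳ (y+[x-y]≈x (f c) (f a))) (*-congʳ (*-congʳ (y+[x-y]≈x M (f a))))) ⟩
      f a * c ⁻¹ * δ + (f c * δ + M * a ⁻¹ * δ) ∎
      where
      e d : Carrier
      e = f c - f a
      d = M - f a

    -- The gaps add up to at most δ (f b - f a) + δ M (a⁻¹ - b⁻¹), arranged here without
    -- subtraction. `M` stays fixed along the recursion because the right end `b` does.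
    uniform-partition : ∀ n {M a b δ} → 0# ≤ δ → 1# ≤ a → f b ≤ M → a + fromℕ (suc n) * δ ≈ b →
      ∃₂ λ S T → StepSum _≤_ g a b S × StepSum _≥_ g a b T ×
                 T + (f a * δ + M * b ⁻¹ * δ) ≤ S + (f b * δ + M * a ⁻¹ * δ)
    uniform-partition zero {M} {a} {b} {δ} 0≤δ 1≤a fb≤M a+δ≈b =
      _ , _ , step a≤b (g-lower 1≤a) nil , step a≤b (g-upper 1≤a) nil , (begin
        f b * a ⁻¹ * (b - a) + 0# + (f a * δ + M * b ⁻¹ * δ)  ≈⟨ +-congʳ (trans (+-identityʳ _) (*-congˡ b-a≈δ)) ⟩
        f b * a ⁻¹ * δ + (f a * δ + M * b ⁻¹ * δ)             ≤⟨ piece-gap 0≤δ 1≤a a≤b (≤-trans (f-mono a≤b) fb≤M) ⟩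
        f a * b ⁻¹ * δ + (f b * δ + M * a ⁻¹ * δ)             ≈⟨ +-congʳ (trans (+-identityʳ _) (*-congˡ b-a≈δ)) ⟨
        f a * b ⁻¹ * (b - a) + 0# + (f b * δ + M * a ⁻¹ * δ)  ∎)
      where
      a+δ≈b′ : a + δ ≈ b
      a+δ≈b′ = trans (+-congˡ (sym (trans (*-congʳ (+-identityʳ 1#)) (*-identityˡ δ)))) a+δ≈b
      a≤b : a ≤ b
      a≤b = ≤-trans (x≤x+y a 0≤δ) (≤-reflexive a+δ≈b′)
      b-a≈δ : b - a ≈ δ
      b-a≈δ = x+y≈z⇒z-x≈y a+δ≈b′
    uniform-partition (suc n) {M} {a} {b} {δ} 0≤δ 1≤a fb≤M a+nδ≈b
      with uniform-partition n {M} {a + δ} {b} {δ} 0≤δ (≤-trans 1≤a (x≤x+y a 0≤δ)) fb≤M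
             (trans
             (solve 3 (λ a m δ → (a :+ δ) :+ m :* δ := a :+ (con 1 :+ m) :* δ) refl a (fromℕ (suc n)) δ)
             a+nδ≈b)
    ... | S , T , s , t , T≤S =
      -- The terms at the junction `c` are added to both sides, which separates the gap of the first
      -- piece from the gap of the rest.
      _ , _ , step a≤c (g-lower 1≤a) s , step a≤c (g-upper 1≤a) t , +-cancelʳ-≤ (f c * δ + M * c ⁻¹ * δ) (begin
        f c * a ⁻¹ * (c - a) + T + (f a * δ + M * b ⁻¹ * δ) + (f c * δ + M * c ⁻¹ * δ)
          ≈⟨ +-congʳ (+-congʳ (+-congʳ (*-congˡ c-a≈δ))) ⟩
        f c * a ⁻¹ * δ + T + (f a * δ + M * b ⁻¹ * δ) + (f c * δ + M * c ⁻¹ * δ)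
          ≈⟨ solve 6 (λ p T q r s u → p :+ T :+ (q :+ r) :+ (s :+ u) := (p :+ (q :+ u)) :+ (T :+ (s :+ r))) refl
               (f c * a ⁻¹ * δ) T (f a * δ) (M * b ⁻¹ * δ) (f c * δ) (M * c ⁻¹ * δ) ⟩
        (f c * a ⁻¹ * δ + (f a * δ + M * c ⁻¹ * δ)) + (T + (f c * δ + M * b ⁻¹ * δ))
          ≤⟨ +-mono-≤ (piece-gap 0≤δ 1≤a a≤c (≤-trans (f-mono (≤-trans a≤c (StepSum⇒≤ s))) fb≤M)) T≤S ⟩
        (f a * c ⁻¹ * δ + (f c * δ + M * a ⁻¹ * δ)) + (S + (f b * δ + M * c ⁻¹ * δ))
          ≈⟨ solve 6 (λ p S q r s u → (p :+ (q :+ u)) :+ (S :+ (s :+ r)) := p :+ S :+ (s :+ u) :+ (q :+ r)) refl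
               (f a * c ⁻¹ * δ) S (f c * δ) (M * c ⁻¹ * δ) (f b * δ) (M * a ⁻¹ * δ) ⟩
        f a * c ⁻¹ * δ + S + (f b * δ + M * a ⁻¹ * δ) + (f c * δ + M * c ⁻¹ * δ)
          ≈⟨ +-congʳ (+-congʳ (+-congʳ (*-congˡ c-a≈δ))) ⟨
        f a * c ⁻¹ * (c - a) + S + (f b * δ + M * a ⁻¹ * δ) + (f c * δ + M * c ⁻¹ * δ) ∎)
      where
      c : Carrier
      c = a + δ
      a≤c : a ≤ c
      a≤c = x≤x+y a 0≤δ
      c-a≈δ : c - a ≈ δ
      c-a≈δ = x+y≈z⇒z-x≈y refl

    F : Carrier → Carrier
    F x = sup (StepSum _≤_ g 1# x)

    F-isIntegral : ∀ x → 1# ≤ x → IsIntegral g 1# x (F x)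
    F-isIntegral x 1≤x = darboux-criterion gap
      where
      gap : ∀ ε → 0# < ε → ∃₂ λ S T → StepSum _≤_ g 1# x S × StepSum _≥_ g 1# x T × T ≤ S + ε
      gap ε 0<ε = let S , T , s , t , T≤S = partition in S , T , s , t , (begin
        T                                             ≤⟨ x≤x+y T (+-nonNeg (*-nonNeg (f-nonNeg _) 0≤δ)
                                                           (*-nonNeg (*-nonNeg (f-nonNeg _) 0≤x⁻¹) 0≤δ)) ⟩
        T + (f 1# * δ + f x * x ⁻¹ * δ)               ≤⟨ T≤S ⟩
        S + (f x * δ + f x * 1# ⁻¹ * δ)               ≤⟨ +-monoʳ-≤ S (+-monoʳ-≤ _ (*-monoˡ-≤ 0≤δ
                                                           (*-monoʳ-≤ (f-nonNeg x) (1≤x⇒x⁻¹≤1 ≤-refl)))) ⟩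
        S + (f x * δ + f x * 1# * δ)
          ≈⟨ +-congˡ (solve 2 (λ p δ → p :* δ :+ p :* con 1 :* δ := con 2 :* p :* δ) refl (f x) δ) ⟩
        S + 2# * f x * δ                              ≤⟨ +-monoʳ-≤ S 2fxδ≤ε ⟩
        S + ε                                         ∎)
        where
        -- With `M` = f x the partition leaves a gap of at most 2 f(x) δ, which n + 1 pieces bring
        -- below ε.
        n : ℕ
        n = proj₁ (archimedean (2# * f x * (x - 1#) * ε ⁻¹))
        small : 2# * f x * (x - 1#) * ε ⁻¹ < fromℕ n
        small = proj₂ (archimedean (2# * f x * (x - 1#) * ε ⁻¹))
        N δ : Carrier
        N = fromℕ (suc n)
        δ = N ⁻¹ * (x - 1#)
        0<N : 0# < N
        0<N = 1≤x⇒0<x (1≤fromℕ {suc n} (ℕ.s≤s ℕ.z≤n))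
        0≤δ : 0# ≤ δ
        0≤δ = *-nonNeg (<⇒≤ (0<x⁻¹ 0<N)) (x≤y⇒0≤y-x 1≤x)
        0≤x⁻¹ : 0# ≤ x ⁻¹
        0≤x⁻¹ = <⇒≤ (0<x⁻¹ (1≤x⇒0<x 1≤x))
        partition = uniform-partition n {f x} {1#} {x} {δ} 0≤δ ≤-refl ≤-refl
          (trans (+-congˡ (x*[x⁻¹*y]≈y 0<N (x - 1#))) (y+[x-y]≈x x 1#))
        2fxδ≤ε : 2# * f x * δ ≤ ε
        2fxδ≤ε = *-cancelˡ-≤ 0<N (begin
          N * (2# * f x * δ)
            ≈⟨ solve 3 (λ a b c → a :* (b :* c) := b :* (a :* c)) refl N (2# * f x) δ ⟩
          2# * f x * (N * δ)                          ≈⟨ *-congˡ (x*[x⁻¹*y]≈y 0<N (x - 1#)) ⟩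
          2# * f x * (x - 1#)                         ≈⟨ x*[x⁻¹*y]≈y 0<ε _ ⟨
          ε * (ε ⁻¹ * (2# * f x * (x - 1#)))          ≈⟨ *-congˡ (*-comm (ε ⁻¹) _) ⟩
          ε * (2# * f x * (x - 1#) * ε ⁻¹)            ≤⟨ *-monoʳ-≤ (<⇒≤ 0<ε) (<⇒≤ small) ⟩
          ε * fromℕ n                                 ≤⟨ *-monoʳ-≤ (<⇒≤ 0<ε) (x≤y+x _ 0≤1) ⟩
          ε * N                                       ≈⟨ *-comm ε N ⟩
          N * ε                                       ∎)

  -- Regular growth and logarithmic integrals

  infix 4 _≲_

  Eventually : (Carrier → Set) → Set
  Eventually P = ∃ λ x₀ → 1# ≤ x₀ × (∀ x → x₀ ≤ x → P x)

  eventually : ∀ {P : Carrier → Set} x₀ → (∀ x → x₀ ≤ x → P x) → Eventually P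
  eventually x₀ p with upperBound₂ 1# x₀
  ... | y₀ , 1≤y₀ , x₀≤y₀ = y₀ , 1≤y₀ , λ x y₀≤x → p x (≤-trans x₀≤y₀ y₀≤x)

  eventually-zip : ∀ {P Q R : Carrier → Set} → (∀ x → 1# ≤ x → P x → Q x → R x) →
                   Eventually P → Eventually Q → Eventually R
  eventually-zip f (x₀ , 1≤x₀ , p) (y₀ , _ , q) with upperBound₂ x₀ y₀
  ... | z₀ , x₀≤z₀ , y₀≤z₀ = z₀ , ≤-trans 1≤x₀ x₀≤z₀ , λ x z₀≤x →
    f x (≤-trans 1≤x₀ (≤-trans x₀≤z₀ z₀≤x)) (p x (≤-trans x₀≤z₀ z₀≤x)) (q x (≤-trans y₀≤z₀ z₀≤x))

  eventually-map : ∀ {P Q : Carrier → Set} → (∀ x → 1# ≤ x → P x → Q x) → Eventually P → Eventually Q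
  eventually-map f (x₀ , 1≤x₀ , p) = x₀ , 1≤x₀ , λ x x₀≤x → f x (≤-trans 1≤x₀ x₀≤x) (p x x₀≤x)

  -- The relation O for nonnegative functions, freed of absolute values. A constant at least 1 is at
  -- most its own powers, and a threshold at least 1 keeps arguments in the range of the integrals.
  _≲_ : (f g : Carrier → Carrier) → Set
  f ≲ g = ∃ λ C → 1# ≤ C × Eventually (λ x → f x ≤ C * g x)

  -- The witness in `LogIntegralΘ` is specified only on [1 , ∞), so its nonnegativity can be asked
  -- only there.
  NonnegativeFrom1 : (Carrier → Carrier) → Set
  NonnegativeFrom1 f = ∀ x → 1# ≤ x → 0# ≤ f x

  =O⇒≲ : ∀ {f g} → NonnegativeFrom1 f → NonnegativeFrom1 g → f =O g → f ≲ g
  =O⇒≲ {f} {g} 0≤f 0≤g (C , x₀ , 0<C , f≤Cg) with upperBound₂ 1# C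
  ... | K , 1≤K , C≤K = K , 1≤K , eventually-map (λ x 1≤x le → begin
      f x            ≈⟨ ∣x∣≈x (0≤f x 1≤x) ⟨
      ∣ f x ∣        ≤⟨ le ⟩
      C * ∣ g x ∣    ≈⟨ *-congˡ (∣x∣≈x (0≤g x 1≤x)) ⟩
      C * g x        ≤⟨ *-monoˡ-≤ (0≤g x 1≤x) C≤K ⟩
      K * g x        ∎) (eventually x₀ f≤Cg)

  ≲⇒=O : ∀ {f g} → NonnegativeFrom1 f → NonnegativeFrom1 g → f ≲ g → f =O g
  ≲⇒=O {f} {g} 0≤f 0≤g (C , 1≤C , x₀ , 1≤x₀ , f≤Cg) = C , x₀ , 1≤x⇒0<x 1≤C , λ x x₀≤x → begin
      ∣ f x ∣        ≈⟨ ∣x∣≈x (0≤f x (≤-trans 1≤x₀ x₀≤x)) ⟩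
      f x            ≤⟨ f≤Cg x x₀≤x ⟩
      C * g x        ≈⟨ *-congˡ (∣x∣≈x (0≤g x (≤-trans 1≤x₀ x₀≤x))) ⟨
      C * ∣ g x ∣    ∎

  Doubling : (Carrier → Carrier) → Set
  Doubling f = (λ x → f (2# * x)) ≲ f

  ExpandsBy : Carrier → (Carrier → Carrier) → Set
  ExpandsBy Λ f = Eventually λ x → 2# * f x ≤ f (Λ * x)

  -- For nondecreasing `f` a factor Λ may always be enlarged; 2 ≤ Λ then gives Λ^n ≥ 2^n, so that
  -- finitely many steps by Λ reach any point.
  Expanding : (Carrier → Carrier) → Set
  Expanding f = ∃ λ Λ → 2# ≤ Λ × ExpandsBy Λ f

  RegularGrowth : (Carrier → Carrier) → Set
  RegularGrowth f = Doubling f × Expanding f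

  module Growth (f : Carrier → Carrier) (f-mono : Monotone f) (f-nonNeg : Nonnegative f) where

    open LogIntegrand f f-mono f-nonNeg

    f-cong : ∀ {x y} → x ≈ y → f x ≈ f y
    f-cong x≈y = antisym (f-mono (≤-reflexive x≈y)) (f-mono (≤-reflexive (sym x≈y)))

    dilate-iterate : ∀ {c} → 1# ≤ c → (λ x → f (c * x)) ≲ f → ∀ n → (λ x → f (c ^ n * x)) ≲ f
    dilate-iterate {c} 1≤c (C , 1≤C , x₀ , 1≤x₀ , le) n = C ^ n , 1≤^ n 1≤C , x₀ , 1≤x₀ , λ x → go n x
      where
      0≤C = <⇒≤ (1≤x⇒0<x 1≤C)
      go : ∀ n x → x₀ ≤ x → f (c ^ n * x) ≤ C ^ n * f x
      go zero    x x₀≤x = ≤-reflexive (trans (f-cong (*-identityˡ x)) (sym (*-identityˡ (f x))))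
      go (suc n) x x₀≤x = begin
        f (c * c ^ n * x)       ≈⟨ f-cong (*-assoc c (c ^ n) x) ⟩
        f (c * (c ^ n * x))
          ≤⟨ le (c ^ n * x) (≤-trans x₀≤x (x≤c*x (1≤^ n 1≤c) (<⇒≤ (1≤x⇒0<x (≤-trans 1≤x₀ x₀≤x))))) ⟩
        C * f (c ^ n * x)       ≤⟨ *-monoʳ-≤ 0≤C (go n x x₀≤x) ⟩
        C * (C ^ n * f x)       ≈⟨ *-assoc C (C ^ n) (f x) ⟨
        C * C ^ n * f x         ∎

    dilate-≤ : ∀ {c d} → c ≤ d → (λ x → f (d * x)) ≲ f → (λ x → f (c * x)) ≲ f
    dilate-≤ c≤d (C , 1≤C , le) = C , 1≤C ,
      eventually-map (λ x 1≤x → ≤-trans (f-mono (*-monoˡ-≤ (<⇒≤ (1≤x⇒0<x 1≤x)) c≤d))) le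

    doubling⇒dilate : Doubling f → ∀ c → (λ x → f (c * x)) ≲ f
    doubling⇒dilate D c with ∃2^n≥ c
    ... | n , c≤2^n = dilate-≤ c≤2^n (dilate-iterate 1≤2 D n)

    -- The threshold is read off the hypothesis within the type: iteration only moves arguments to
    -- the right, so the same one serves every `n`.
    expand-iterate : ∀ {Λ} → 1# ≤ Λ → ((x₀ , _) : ExpandsBy Λ f) → ∀ n x → x₀ ≤ x → 2# ^ n * f x ≤ f (Λ ^ n * x)
    expand-iterate {Λ} 1≤Λ _ zero x x₀≤x = ≤-reflexive (trans (*-identityˡ (f x)) (sym (f-cong (*-identityˡ x))))
    expand-iterate {Λ} 1≤Λ G@(x₀ , 1≤x₀ , le) (suc n) x x₀≤x = begin
      2# * 2# ^ n * f x      ≈⟨ *-assoc 2# (2# ^ n) (f x) ⟩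
      2# * (2# ^ n * f x)    ≤⟨ *-monoʳ-≤ 0≤2 (expand-iterate 1≤Λ G n x x₀≤x) ⟩
      2# * f (Λ ^ n * x)
        ≤⟨ le (Λ ^ n * x) (≤-trans x₀≤x (x≤c*x (1≤^ n 1≤Λ) (<⇒≤ (1≤x⇒0<x (≤-trans 1≤x₀ x₀≤x))))) ⟩
      f (Λ * (Λ ^ n * x))    ≈⟨ f-cong (*-assoc Λ (Λ ^ n) x) ⟨
      f (Λ * Λ ^ n * x)      ∎

    expandsBy⇒expanding : ∀ Λ → ExpandsBy Λ f → Expanding f
    expandsBy⇒expanding Λ G with upperBound₂ 2# Λ
    ... | Λ′ , 2≤Λ′ , Λ≤Λ′ = Λ′ , 2≤Λ′ ,
      eventually-map (λ x 1≤x le → ≤-trans le (f-mono (*-monoˡ-≤ (<⇒≤ (1≤x⇒0<x 1≤x)) Λ≤Λ′))) G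

    zeroLowerSum : ∀ {a b} → 1# ≤ a → a ≤ b → StepSum _≤_ g a b (0# * (b - a) + 0#)
    zeroLowerSum 1≤a a≤b = step a≤b (λ t a≤t _ →
      *-nonNeg (f-nonNeg t) (<⇒≤ (0<x⁻¹ (1≤x⇒0<x (≤-trans 1≤a a≤t))))) nil

    0*x+0≈0 : ∀ x → 0# * x + 0# ≈ 0#
    0*x+0≈0 x = trans (+-identityʳ _) (zeroˡ x)

    -- Estimates for an integral function F of f(t)/t

    module FromIntegral (F : Carrier → Carrier) (F-integral : ∀ x → 1# ≤ x → IsIntegral g 1# x (F x)) where

      lowerSum≤F : ∀ {x S} → 1# ≤ x → StepSum _≤_ g 1# x S → S ≤ F x
      lowerSum≤F 1≤x s = proj₁ (proj₁ (F-integral _ 1≤x)) s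

      F≤upperSum : ∀ {x S} → 1# ≤ x → StepSum _≥_ g 1# x S → F x ≤ S
      F≤upperSum 1≤x s = proj₁ (proj₂ (F-integral _ 1≤x)) s

      F-nonNeg : NonnegativeFrom1 F
      F-nonNeg x 1≤x = ≤-respˡ-≈ (0*x+0≈0 _) (lowerSum≤F 1≤x (zeroLowerSum ≤-refl 1≤x))

      -- `F y` is the infimum of the upper sums over [1 , y], and each of them extends by a
      -- rectangle over [y , z] to an upper sum over [1 , z].
      F-increment : ∀ {y z} → 1# ≤ y → y ≤ z → F z ≤ F y + f z * y ⁻¹ * (z - y)
      F-increment {y} {z} 1≤y y≤z = +-cancelˡ-≤ (- V) (≤-trans
        (proj₂ (proj₂ (F-integral y 1≤y)) lowerBound)
        (≤-reflexive (sym (-V+[w+V]≈w (F y)))))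
        where
        V : Carrier
        V = f z * y ⁻¹ * (z - y)
        -V+[w+V]≈w : ∀ w → - V + (w + V) ≈ w
        -V+[w+V]≈w w = trans (solve 3 (λ a b c → a :+ (b :+ c) := b :+ (c :+ a)) refl (- V) w V)
                         (trans (+-congˡ (-‿inverseʳ V)) (+-identityʳ w))
        lowerBound : IsLowerBound (StepSum _≥_ g 1# y) (- V + F z)
        lowerBound {U} u with snoc u y≤z (g-upper 1≤y)
        ... | T , t , T≈U+V = begin
          - V + F z      ≤⟨ +-monoʳ-≤ (- V) (F≤upperSum (≤-trans 1≤y y≤z) t) ⟩
          - V + T        ≈⟨ +-congˡ T≈U+V ⟩
          - V + (U + V)  ≈⟨ -V+[w+V]≈w U ⟩
          U              ∎

      doubling : F ≲ f → f ≲ F → Doubling f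
      doubling (C , 1≤C , x₀ , 1≤x₀ , F≤Cf) (K , 1≤K , y₀ , 1≤y₀ , f≤KF) with archimedean (2# * K)
      ... | n , 2K<n = dilate-≤ 2≤c^n (dilate-iterate 1≤c
              (2# * K * C , 1≤x*y (1≤x*y 1≤2 1≤K) 1≤C , eventually-zip bound
                 (x₀ , 1≤x₀ , F≤Cf)
                 (y₀ , 1≤y₀ , λ y y₀≤y → f≤KF (c * y) (≤-trans y₀≤y (x≤c*x 1≤c (<⇒≤ (1≤x⇒0<x (≤-trans 1≤y₀ y₀≤y))))))) n)
        where
        0<2K : 0# < 2# * K
        0<2K = 1≤x⇒0<x (1≤x*y 1≤2 1≤K)
        d c : Carrier
        d = (2# * K) ⁻¹
        c = 1# + d
        0≤d : 0# ≤ d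
        0≤d = <⇒≤ (0<x⁻¹ 0<2K)
        1≤c : 1# ≤ c
        1≤c = x≤x+y 1# 0≤d
        2≤c^n : 2# ≤ c ^ n
        2≤c^n = begin
          1# + 1#                ≈⟨ +-congˡ (*-inverseʳ (≉0 0<2K)) ⟨
          1# + 2# * K * d        ≤⟨ +-monoʳ-≤ 1# (*-monoˡ-≤ 0≤d (<⇒≤ 2K<n)) ⟩
          1# + fromℕ n * d       ≤⟨ bernoulli 0≤d n ⟩
          c ^ n                  ∎
        -- The estimate of `p` is doubled first: since `2# * K * d` is 1, the increment contributes
        -- exactly one `p` on the right, and one of the two on the left survives cancellation.
        bound : ∀ y → 1# ≤ y → F y ≤ C * f y → f (c * y) ≤ K * F (c * y) → f (c * y) ≤ 2# * K * C * f y
        bound y 1≤y Fy≤ fcy≤ = +-cancelʳ-≤ p (begin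
          p + p                                         ≤⟨ +-mono-≤ fcy≤ fcy≤ ⟩
          K * F (c * y) + K * F (c * y)
            ≈⟨ solve 2 (λ k u → k :* u :+ k :* u := con 2 :* k :* u) refl K (F (c * y)) ⟩
          2# * K * F (c * y)                            ≤⟨ *-monoʳ-≤ (<⇒≤ 0<2K) (F-increment 1≤y y≤cy) ⟩
          2# * K * (F y + p * y ⁻¹ * (c * y - y))
            ≈⟨ *-congˡ (+-congˡ (*-congˡ (x+y≈z⇒z-x≈y
                (solve 2 (λ y d → y :+ d :* y := (con 1 :+ d) :* y) refl y d)))) ⟩
          2# * K * (F y + p * y ⁻¹ * (d * y))
            ≈⟨ solve 6 (λ k u p r d y → k :* (u :+ p :* r :* (d :* y)) := k :* u :+ p :* (k :* d) :* (r :* y))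
                refl (2# * K) (F y) p (y ⁻¹) d y ⟩
          2# * K * F y + p * (2# * K * d) * (y ⁻¹ * y)
            ≈⟨ +-congˡ (*-cong (trans (*-congˡ (*-inverseʳ (≉0 0<2K))) (*-identityʳ p))
                               (*-inverseˡ (≉0 (1≤x⇒0<x 1≤y)))) ⟩
          2# * K * F y + p * 1#                         ≈⟨ +-congˡ (*-identityʳ p) ⟩
          2# * K * F y + p                              ≤⟨ +-monoˡ-≤ p (*-monoʳ-≤ (<⇒≤ 0<2K) Fy≤) ⟩
          2# * K * (C * f y) + p                        ≈⟨ +-congʳ (*-assoc (2# * K) C (f y)) ⟨
          2# * K * C * f y + p                          ∎)
          where
          p : Carrier
          p = f (c * y)
          y≤cy : y ≤ c * y
          y≤cy = x≤c*x 1≤c (<⇒≤ (1≤x⇒0<x 1≤y))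

      -- The rectangle of height f(z)/(2z) over [z , 2z] has area f(z)/2, which is at least f(x)/2
      -- by monotonicity.
      dyadicLowerSum : ∀ {x} → 1# ≤ x → ∀ n → ∃ λ S → StepSum _≤_ g 1# (2# ^ n * x) S × fromℕ n * f x ≤ 2# * S
      dyadicLowerSum {x} 1≤x zero = _ , zeroLowerSum ≤-refl (1≤x*y ≤-refl 1≤x) ,
        ≤-reflexive (trans (zeroˡ (f x)) (sym (trans (*-congˡ (0*x+0≈0 _)) (zeroʳ 2#))))
      dyadicLowerSum {x} 1≤x (suc n) with dyadicLowerSum 1≤x n
      ... | S , s , le = let T , t , T≈ = snoc s z≤z′ (g-lower 1≤z) in T , t , (begin
        (1# + fromℕ n) * f x
          ≈⟨ solve 2 (λ n p → (con 1 :+ n) :* p := n :* p :+ p) refl (fromℕ n) (f x) ⟩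
        fromℕ n * f x + f x                         ≤⟨ +-mono-≤ le (f-mono (x≤c*x (1≤^ n 1≤2) (<⇒≤ (1≤x⇒0<x 1≤x)))) ⟩
        2# * S + f z
          ≈⟨ +-congˡ (trans (*-congˡ (*-inverseˡ (≉0 0<z′))) (*-identityʳ (f z))) ⟨
        2# * S + f z * (z′ ⁻¹ * z′)                 ≈⟨ +-congˡ (*-congˡ (*-congˡ (*-assoc 2# (2# ^ n) x))) ⟩
        2# * S + f z * (z′ ⁻¹ * (2# * z))
          ≈⟨ solve 4 (λ S p r z → con 2 :* S :+ p :* (r :* (con 2 :* z)) := con 2 :* (S :+ p :* r :* z))
               refl S (f z) (z′ ⁻¹) z ⟩
        2# * (S + f z * z′ ⁻¹ * z)                  ≈⟨ *-congˡ (+-congˡ (*-congˡ z′-z≈z)) ⟨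
        2# * (S + f z * z′ ⁻¹ * (z′ - z))           ≈⟨ *-congˡ T≈ ⟨
        2# * T                                      ∎)
        where
        z z′ : Carrier
        z = 2# ^ n * x
        z′ = 2# * 2# ^ n * x
        1≤z : 1# ≤ z
        1≤z = 1≤x*y (1≤^ n 1≤2) 1≤x
        z≤z′ : z ≤ z′
        z≤z′ = *-monoˡ-≤ (<⇒≤ (1≤x⇒0<x 1≤x)) (x≤c*x 1≤2 (<⇒≤ (1≤x⇒0<x (1≤^ n 1≤2))))
        0<z′ : 0# < z′
        0<z′ = 1≤x⇒0<x (1≤x*y (1≤^ (suc n) 1≤2) 1≤x)
        z′-z≈z : z′ - z ≈ z
        z′-z≈z = x+y≈z⇒z-x≈y (solve 2 (λ q x → q :* x :+ q :* x := con 2 :* q :* x) refl (2# ^ n) x)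

      expanding : F ≲ f → Expanding f
      -- The lower sum gives n f(x) ≤ 2 F(2^n x) ≤ 2C f(2^n x); `n` above 4C leaves the factor 2
      -- after division by 2C.
      expanding (C , 1≤C , x₀ , 1≤x₀ , F≤Cf) with archimedean (2# * C * 2#)
      ... | n , 4C<n = expandsBy⇒expanding (2# ^ n) (x₀ , 1≤x₀ , bound)
        where
        bound : ∀ x → x₀ ≤ x → 2# * f x ≤ f (2# ^ n * x)
        bound x x₀≤x with dyadicLowerSum (≤-trans 1≤x₀ x₀≤x) n
        ... | S , s , nfx≤2S = *-cancelˡ-≤ (1≤x⇒0<x (1≤x*y 1≤2 1≤C)) (begin
          2# * C * (2# * f x)           ≈⟨ *-assoc (2# * C) 2# (f x) ⟨
          2# * C * 2# * f x             ≤⟨ *-monoˡ-≤ (f-nonNeg x) (<⇒≤ 4C<n) ⟩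
          fromℕ n * f x                 ≤⟨ nfx≤2S ⟩
          2# * S                        ≤⟨ *-monoʳ-≤ 0≤2 (lowerSum≤F (≤-trans 1≤x₀ x₀≤z) s) ⟩
          2# * F (2# ^ n * x)           ≤⟨ *-monoʳ-≤ 0≤2 (F≤Cf (2# ^ n * x) x₀≤z) ⟩
          2# * (C * f (2# ^ n * x))     ≈⟨ *-assoc 2# C (f (2# ^ n * x)) ⟨
          2# * C * f (2# ^ n * x)       ∎)
          where
          x₀≤z : x₀ ≤ 2# ^ n * x
          x₀≤z = ≤-trans x₀≤x (x≤c*x (1≤^ n 1≤2) (<⇒≤ (1≤x⇒0<x (≤-trans 1≤x₀ x₀≤x))))

      -- With y = x/2, the rectangle of height f(y)/x over [y , x] has area f(y)/2. The lower step
      -- function is 0 to its left, and doubling passes from f(y) to f(x).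
      f≲F : Doubling f → f ≲ F
      f≲F (C , 1≤C , x₀ , 1≤x₀ , f2≤Cf) = 2# * C , 1≤x*y 1≤2 1≤C , 2# * x₀ , 1≤x*y 1≤2 1≤x₀ , bound
        where
        bound : ∀ x → 2# * x₀ ≤ x → f x ≤ 2# * C * F x
        bound x 2x₀≤x = let T , t , T≈ = snoc (zeroLowerSum ≤-refl 1≤y) y≤x (g-lower 1≤y) in begin
          f x                              ≈⟨ f-cong 2y≈x ⟨
          f (2# * y)                       ≤⟨ f2≤Cf y x₀≤y ⟩
          C * f y                          ≈⟨ *-congˡ (trans (*-congˡ (*-inverseˡ (≉0 0<x))) (*-identityʳ (f y))) ⟨
          C * (f y * (x ⁻¹ * x))           ≈⟨ *-congˡ (*-congˡ (*-congˡ 2y≈x)) ⟨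
          C * (f y * (x ⁻¹ * (2# * y)))
            ≈⟨ solve 4 (λ C p r y → C :* (p :* (r :* (con 2 :* y))) := con 2 :* C :* (p :* r :* y))
                 refl C (f y) (x ⁻¹) y ⟩
          2# * C * (f y * x ⁻¹ * y)        ≈⟨ *-congˡ (*-congˡ x-y≈y) ⟨
          2# * C * (f y * x ⁻¹ * (x - y))  ≈⟨ *-congˡ (trans T≈ (trans (+-congʳ (0*x+0≈0 _)) (+-identityˡ _))) ⟨
          2# * C * T
            ≤⟨ *-monoʳ-≤ (<⇒≤ (1≤x⇒0<x (1≤x*y 1≤2 1≤C))) (lowerSum≤F (≤-trans 1≤y y≤x) t) ⟩
          2# * C * F x                     ∎
          where
          y : Carrier
          y = 2# ⁻¹ * x
          2y≈x : 2# * y ≈ x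
          2y≈x = x*[x⁻¹*y]≈y 0<2 x
          x₀≤y : x₀ ≤ y
          x₀≤y = *-cancelˡ-≤ 0<2 (≤-trans 2x₀≤x (≤-reflexive (sym 2y≈x)))
          1≤y : 1# ≤ y
          1≤y = ≤-trans 1≤x₀ x₀≤y
          0≤y : 0# ≤ y
          0≤y = <⇒≤ (1≤x⇒0<x 1≤y)
          y≤x : y ≤ x
          y≤x = ≤-respʳ-≈ 2y≈x (x≤c*x 1≤2 0≤y)
          0<x : 0# < x
          0<x = 1≤x⇒0<x (≤-trans 1≤y y≤x)
          x-y≈y : x - y ≈ y
          x-y≈y = x+y≈z⇒z-x≈y (trans (solve 1 (λ y → y :+ y := con 2 :* y) refl y) 2y≈x)

      F≲f : Expanding f → F ≲ f
      F≲f (Λ , 2≤Λ , x₀ , 1≤x₀ , 2f≤fΛ) = K , 1≤K , x₀ , 1≤x₀ , bound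
        where
        1≤Λ : 1# ≤ Λ
        1≤Λ = ≤-trans 1≤2 2≤Λ
        0<Λ : 0# < Λ
        0<Λ = 1≤x⇒0<x 1≤Λ
        0≤x₀ : 0# ≤ x₀
        0≤x₀ = <⇒≤ (1≤x⇒0<x 1≤x₀)
        -- The first summand bounds x - 1 in the base case x ≤ Λ x₀; the second gives 2Λ ≤ K, so
        -- that the bound reproduces itself at each further step.
        K : Carrier
        K = Λ * x₀ + 2# * Λ
        1≤K : 1# ≤ K
        1≤K = ≤-trans (1≤x*y 1≤Λ 1≤x₀) (x≤x+y _ (*-nonNeg 0≤2 (<⇒≤ 0<Λ)))

        upperSum-near : ∀ x → x₀ ≤ x → x ≤ Λ * x₀ → ∃ λ U → StepSum _≥_ g 1# x U × U ≤ K * f x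
        upperSum-near x x₀≤x x≤Λx₀ = _ , step 1≤x (g-upper ≤-refl) nil , (begin
          f x * 1# ⁻¹ * (x - 1#) + 0#  ≈⟨ +-identityʳ _ ⟩
          f x * 1# ⁻¹ * (x - 1#)
            ≤⟨ *-mono-≤ 0≤fx*1 (x≤y⇒0≤y-x 1≤x) (*-monoʳ-≤ (f-nonNeg x) (1≤x⇒x⁻¹≤1 ≤-refl)) x-1≤K ⟩
          f x * 1# * K                 ≈⟨ solve 2 (λ p K → p :* con 1 :* K := K :* p) refl (f x) K ⟩
          K * f x                      ∎)
          where
          1≤x : 1# ≤ x
          1≤x = ≤-trans 1≤x₀ x₀≤x
          0≤fx*1 : 0# ≤ f x * 1#
          0≤fx*1 = *-nonNeg (f-nonNeg x) 0≤1
          x-1≤K : x - 1# ≤ K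
          x-1≤K = begin
            x - 1#          ≤⟨ x≤y+x _ 0≤1 ⟩
            1# + (x - 1#)   ≈⟨ y+[x-y]≈x x 1# ⟩
            x               ≤⟨ x≤Λx₀ ⟩
            Λ * x₀          ≤⟨ x≤x+y _ (*-nonNeg 0≤2 (<⇒≤ 0<Λ)) ⟩
            K               ∎

        -- Appending [x/Λ , x] costs at most Λ f(x), while the bound K f(x/Λ) inherited from x/Λ is
        -- at most K f(x)/2. The geometric series is thus hidden in the unchanged constant `K`.
        upperSum : ∀ n x → x₀ ≤ x → x ≤ Λ ^ n * x₀ → ∃ λ U → StepSum _≥_ g 1# x U × U ≤ K * f x
        upperSum zero x x₀≤x x≤x₀ =
          upperSum-near x x₀≤x (≤-trans x≤x₀ (*-monoˡ-≤ 0≤x₀ 1≤Λ))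
        upperSum (suc n) x x₀≤x x≤Λⁿ⁺¹x₀ with total x (Λ * x₀)
        ... | inj₁ x≤Λx₀ = upperSum-near x x₀≤x x≤Λx₀
        ... | inj₂ Λx₀≤x =
          let U , u , U≤Kfy = upperSum n y x₀≤y y≤Λⁿx₀
              T , t , T≈ = snoc u y≤x (g-upper 1≤y)
          in T , t , *-cancelˡ-≤ 0<2 (begin
          2# * T                                       ≈⟨ *-congˡ T≈ ⟩
          2# * (U + f x * y ⁻¹ * (x - y))              ≤⟨ *-monoʳ-≤ 0≤2 (+-mono-≤ U≤Kfy piece≤) ⟩
          2# * (K * f y + Λ * f x)
            ≈⟨ solve 4 (λ K p Λ q → con 2 :* (K :* p :+ Λ :* q) := K :* (con 2 :* p) :+ con 2 :* Λ :* q)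
                 refl K (f y) Λ (f x) ⟩
          K * (2# * f y) + 2# * Λ * f x
            ≤⟨ +-mono-≤ (*-monoʳ-≤ (<⇒≤ (1≤x⇒0<x 1≤K)) 2fy≤fx)
                        (*-monoˡ-≤ (f-nonNeg x) (x≤y+x _ (*-nonNeg (<⇒≤ 0<Λ) 0≤x₀))) ⟩
          K * f x + K * f x                            ≈⟨ solve 1 (λ p → p :+ p := con 2 :* p) refl (K * f x) ⟩
          2# * (K * f x)                               ∎)
          where
          y : Carrier
          y = Λ ⁻¹ * x
          Λy≈x : Λ * y ≈ x
          Λy≈x = x*[x⁻¹*y]≈y 0<Λ x
          x₀≤y : x₀ ≤ y
          x₀≤y = *-cancelˡ-≤ 0<Λ (≤-respʳ-≈ (sym Λy≈x) Λx₀≤x)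
          y≤Λⁿx₀ : y ≤ Λ ^ n * x₀
          y≤Λⁿx₀ = *-cancelˡ-≤ 0<Λ (≤-respˡ-≈ (sym Λy≈x) (≤-respʳ-≈ (*-assoc Λ (Λ ^ n) x₀) x≤Λⁿ⁺¹x₀))
          1≤y : 1# ≤ y
          1≤y = ≤-trans 1≤x₀ x₀≤y
          0<y : 0# < y
          0<y = 1≤x⇒0<x 1≤y
          y≤x : y ≤ x
          y≤x = ≤-respʳ-≈ Λy≈x (x≤c*x 1≤Λ (<⇒≤ 0<y))
          2fy≤fx : 2# * f y ≤ f x
          2fy≤fx = ≤-respʳ-≈ (f-cong Λy≈x) (2f≤fΛ y x₀≤y)
          piece≤ : f x * y ⁻¹ * (x - y) ≤ Λ * f x
          piece≤ = begin
            f x * y ⁻¹ * (x - y)        ≤⟨ *-monoʳ-≤ (*-nonNeg (f-nonNeg x) (<⇒≤ (0<x⁻¹ 0<y))) (x≤y+x _ (<⇒≤ 0<y)) ⟩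
            f x * y ⁻¹ * (y + (x - y))  ≈⟨ *-congˡ (trans (y+[x-y]≈x x y) (sym Λy≈x)) ⟩
            f x * y ⁻¹ * (Λ * y)
              ≈⟨ solve 4 (λ p r Λ y → p :* r :* (Λ :* y) := Λ :* p :* (r :* y)) refl (f x) (y ⁻¹) Λ y ⟩
            Λ * f x * (y ⁻¹ * y)        ≈⟨ trans (*-congˡ (*-inverseˡ (≉0 0<y))) (*-identityʳ _) ⟩
            Λ * f x                     ∎

        bound : ∀ x → x₀ ≤ x → F x ≤ K * f x
        bound x x₀≤x with ∃2^n≥ x
        ... | n , x≤2ⁿ with upperSum n x x₀≤x (begin
                x             ≤⟨ x≤2ⁿ ⟩
                2# ^ n        ≤⟨ ^-monoˡ-≤ n 0≤2 2≤Λ ⟩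
                Λ ^ n         ≈⟨ *-identityʳ _ ⟨
                Λ ^ n * 1#    ≤⟨ *-monoʳ-≤ (^-nonNeg n (<⇒≤ 0<Λ)) 1≤x₀ ⟩
                Λ ^ n * x₀    ∎)
        ...   | U , u , U≤Kfx = ≤-trans (F≤upperSum (≤-trans 1≤x₀ x₀≤x) u) U≤Kfx

    logIntegralΘ⇔regularGrowth : LogIntegralΘ f ⇔ RegularGrowth f
    logIntegralΘ⇔regularGrowth = mk⇔ to from
      where
      f-nonNeg₁ : NonnegativeFrom1 f
      f-nonNeg₁ x _ = f-nonNeg x

      to : LogIntegralΘ f → RegularGrowth f
      to (F , F-integral , F=Of , f=OF) = doubling F≲f′ f≲F′ , expanding F≲f′
        where
        open FromIntegral F F-integral
        F≲f′ : F ≲ f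
        F≲f′ = =O⇒≲ F-nonNeg f-nonNeg₁ F=Of
        f≲F′ : f ≲ F
        f≲F′ = =O⇒≲ f-nonNeg₁ F-nonNeg f=OF

      from : RegularGrowth f → LogIntegralΘ f
      from (D , G) = F , F-isIntegral , ≲⇒=O F-nonNeg f-nonNeg₁ (F≲f G) , ≲⇒=O f-nonNeg₁ F-nonNeg (f≲F D)
        where open FromIntegral F F-isIntegral

  -- Real powers and the lower Matuszewska index

  -‿antitone : ∀ {x y} → x ≤ y → - y ≤ - x
  -‿antitone {x} {y} x≤y = +-cancelˡ-≤ x (+-cancelˡ-≤ y (begin
    y + (x - y)   ≈⟨ y+[x-y]≈x x y ⟩
    x             ≤⟨ x≤y ⟩
    y             ≈⟨ +-identityʳ y ⟨
    y + 0#        ≈⟨ +-congˡ (-‿inverseʳ x) ⟨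
    y + (x - x)   ∎))

  -‿cancel-≤ : ∀ {x y} → - y ≤ - x → x ≤ y
  -‿cancel-≤ {x} {y} le = ≤-respˡ-≈ (-‿involutive x) (≤-respʳ-≈ (-‿involutive y) (-‿antitone le))

  x≤y⁻¹⇒x*y≤1 : ∀ {x y} → 0# < y → x ≤ y ⁻¹ → x * y ≤ 1#
  x≤y⁻¹⇒x*y≤1 0<y x≤y⁻¹ = ≤-trans (*-monoˡ-≤ (<⇒≤ 0<y) x≤y⁻¹) (≤-reflexive (*-inverseˡ (≉0 0<y)))

  x*y≤1⇒x≤y⁻¹ : ∀ {x y} → 0# < y → x * y ≤ 1# → x ≤ y ⁻¹
  x*y≤1⇒x≤y⁻¹ {x} {y} 0<y xy≤1 = *-cancelˡ-≤ 0<y (begin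
    y * x     ≈⟨ *-comm y x ⟩
    x * y     ≤⟨ xy≤1 ⟩
    1#        ≈⟨ *-inverseʳ (≉0 0<y) ⟨
    y * y ⁻¹  ∎)

  -- At x ≈ 1 the case distinction in _^ℝ_ may go either way, whence the strict bound.
  ^ℝ-sup : ∀ {x} γ → 1# < x → x ^ℝ γ ≡ sup (BelowRationalPower x γ)
  ^ℝ-sup {x} γ 1<x with total 1# x
  ... | inj₁ _   = ≡.refl
  ... | inj₂ x≤1 = ⊥-elim (≤⇒≯ x≤1 1<x)

  -- For 0 < γ, the membership y ≤ x^(-n/q) with γ ≤ n/q, cleared of inverses.
  BelowNegativePower : Carrier → Carrier → Pred Carrier 0ℓ
  BelowNegativePower x γ y = 0# ≤ y × ∃₂ λ (n q : ℕ) → 1 ℕ.≤ q × γ * fromℕ q ≤ fromℕ n × y ^ q * x ^ n ≤ 1#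

  module _ {x γ : Carrier} (1<x : 1# < x) (0<γ : 0# < γ) where

    private
      0<x : 0# < x
      0<x = 1≤x⇒0<x (<⇒≤ 1<x)

      0<γq : ∀ {q} → 1 ℕ.≤ q → 0# < γ * fromℕ q
      0<γq 1≤q = *-pos 0<γ (1≤x⇒0<x (1≤fromℕ 1≤q))

      -γq≈ : ∀ q → - γ * fromℕ q ≈ - (γ * fromℕ q)
      -γq≈ q = sym (-‿distribˡ-* γ (fromℕ q))

    below⁻ : ∀ {y} → y ∈ BelowRationalPower x (- γ) → y ∈ BelowNegativePower x γ
    below⁻ (0≤y , ℤ.+ n , q , 1≤q , n≤ , _) = ⊥-elim (≤⇒≯ γq≤0 (0<γq 1≤q))
      where
      γq≤0 : γ * fromℕ q ≤ 0#
      γq≤0 = -‿cancel-≤ (≤-trans (≤-reflexive -0#≈0#) (≤-trans (fromℕ-nonNeg n) (≤-respʳ-≈ (-γq≈ q) n≤)))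
    below⁻ (0≤y , -[1+ n ] , q , 1≤q , n≤ , y^q≤) =
      0≤y , suc n , q , 1≤q , -‿cancel-≤ (≤-respʳ-≈ (-γq≈ q) n≤) , x≤y⁻¹⇒x*y≤1 (^-pos (suc n) 0<x) y^q≤

    below⁺ : ∀ {y} → y ∈ BelowNegativePower x γ → y ∈ BelowRationalPower x (- γ)
    below⁺ (0≤y , zero , q , 1≤q , γq≤0 , _) = ⊥-elim (≤⇒≯ γq≤0 (0<γq 1≤q))
    below⁺ (0≤y , suc n , q , 1≤q , γq≤n , y^q*x^n≤1) =
      0≤y , -[1+ n ] , q , 1≤q , ≤-respʳ-≈ (sym (-γq≈ q)) (-‿antitone γq≤n) ,
      x*y≤1⇒x≤y⁻¹ (^-pos (suc n) 0<x) y^q*x^n≤1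

    -- The integer power x^(-n) with n > γ is an approximant, with q = 1; its positivity passes to
    -- x^(-γ).
    negativePower-inhabited : ∃ λ y → 0# < y × y ∈ BelowNegativePower x γ
    negativePower-inhabited with archimedean γ
    ... | n , γ<n = (x ^ n) ⁻¹ , 0<x⁻¹ (^-pos n 0<x) , <⇒≤ (0<x⁻¹ (^-pos n 0<x)) , n , 1 , ℕ.≤-refl ,
      ≤-respˡ-≈ (sym (trans (*-congˡ (+-identityʳ 1#)) (*-identityʳ γ))) (<⇒≤ γ<n) ,
      ≤-reflexive (trans (*-congʳ (*-identityʳ _)) (*-inverseˡ (≉0 (^-pos n 0<x))))

    negativePower≤1 : ∀ {y} → y ∈ BelowNegativePower x γ → y ≤ 1#
    negativePower≤1 {y} (0≤y , n , q , 1≤q , _ , y^q*x^n≤1) = ^-cancelˡ-≤ q 1≤q 0≤y 0≤1 (begin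
      y ^ q            ≈⟨ *-identityʳ (y ^ q) ⟨
      y ^ q * 1#       ≤⟨ *-monoʳ-≤ (^-nonNeg q 0≤y) (1≤^ n (<⇒≤ 1<x)) ⟩
      y ^ q * x ^ n    ≤⟨ y^q*x^n≤1 ⟩
      1#               ≈⟨ 1^n≈1 q ⟨
      1# ^ q           ∎)

    -- All later estimates of x^(-γ) pass through this: an upper bound is checked on every
    -- approximant, a lower bound follows from exhibiting one.
    ^ℝ-isLub : IsLub (BelowNegativePower x γ) (x ^ℝ (- γ))
    ^ℝ-isLub = ≡.subst (IsLub (BelowNegativePower x γ)) (≡.sym (^ℝ-sup (- γ) 1<x))
      ((λ b → proj₁ lub (below⁺ b)) , λ ub → proj₂ lub (λ b → ub (below⁻ b)))
      where
      lub : IsLub (BelowRationalPower x (- γ)) (sup (BelowRationalPower x (- γ)))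
      lub with negativePower-inhabited
      ... | y , _ , y∈ = sup-isLub (y , below⁺ y∈) (1# , λ b → negativePower≤1 (below⁻ b))

    ^ℝ-pos : 0# < x ^ℝ (- γ)
    ^ℝ-pos with negativePower-inhabited
    ... | y , 0<y , y∈ = <-≤-trans 0<y (proj₁ ^ℝ-isLub y∈)

  ^-^-comm : ∀ x n q → (x ^ n) ^ q ≈ (x ^ q) ^ n
  ^-^-comm x n q = trans (^-assocʳ x n q) (trans (reflexive (≡.cong (x ^_) (ℕ.*-comm n q))) (sym (^-assocʳ x q n)))

  -- Multiplication by `N` carries approximants of (N^r x)^(-γ) to approximants of x^(-γ): for n/q ≥
  -- γ one has q ≤ γ r q ≤ r n, hence N^q ≤ (N^r)^n.
  ^ℝ-decay : ∀ {x γ} r N → 1# < x → 0# < γ → 1# ≤ γ * fromℕ r → 1# ≤ N →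
             N * (N ^ r * x) ^ℝ (- γ) ≤ x ^ℝ (- γ)
  ^ℝ-decay {x} {γ} r N 1<x 0<γ 1≤γr 1≤N = begin
    N * (N ^ r * x) ^ℝ (- γ)           ≤⟨ *-monoʳ-≤ (<⇒≤ 0<N) (proj₂ (^ℝ-isLub 1<Λx 0<γ) λ y∈ →
                                             ≤-respˡ-≈ (x⁻¹*[x*y]≈y 0<N _)
                                             (*-monoʳ-≤ (<⇒≤ (0<x⁻¹ 0<N)) (proj₁ (^ℝ-isLub 1<x 0<γ) (scale y∈)))) ⟩
    N * (N ⁻¹ * x ^ℝ (- γ))            ≈⟨ x*[x⁻¹*y]≈y 0<N _ ⟩
    x ^ℝ (- γ)                         ∎
    where
    0<N : 0# < N
    0<N = 1≤x⇒0<x 1≤N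
    1<Λx : 1# < N ^ r * x
    1<Λx = <-≤-trans 1<x (x≤c*x (1≤^ r 1≤N) (<⇒≤ (1≤x⇒0<x (<⇒≤ 1<x))))
    scale : ∀ {y} → y ∈ BelowNegativePower (N ^ r * x) γ → N * y ∈ BelowNegativePower x γ
    scale {y} (0≤y , n , q , 1≤q , γq≤n , le) = *-nonNeg (<⇒≤ 0<N) 0≤y , n , q , 1≤q , γq≤n , (begin
      (N * y) ^ q * x ^ n              ≈⟨ *-congʳ (^-distrib-* N y q) ⟩
      N ^ q * y ^ q * x ^ n            ≤⟨ *-monoˡ-≤ 0≤xⁿ (*-monoˡ-≤ (^-nonNeg q 0≤y) (^-monoʳ-≤ 1≤N q≤rn)) ⟩
      N ^ (r ℕ.* n) * y ^ q * x ^ n    ≈⟨ *-congʳ (*-congʳ (^-assocʳ N r n)) ⟨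
      (N ^ r) ^ n * y ^ q * x ^ n
        ≈⟨ solve 3 (λ a b c → a :* b :* c := b :* (a :* c)) refl ((N ^ r) ^ n) (y ^ q) (x ^ n) ⟩
      y ^ q * ((N ^ r) ^ n * x ^ n)    ≈⟨ *-congˡ (^-distrib-* (N ^ r) x n) ⟨
      y ^ q * (N ^ r * x) ^ n          ≤⟨ le ⟩
      1#                               ∎)
      where
      0≤xⁿ : 0# ≤ x ^ n
      0≤xⁿ = ^-nonNeg n (<⇒≤ (1≤x⇒0<x (<⇒≤ 1<x)))
      q≤rn : q ℕ.≤ r ℕ.* n
      q≤rn = fromℕ-cancel-≤ (begin
        fromℕ q                      ≤⟨ x≤c*x 1≤γr (fromℕ-nonNeg q) ⟩
        γ * fromℕ r * fromℕ q        ≈⟨ solve 3 (λ γ r q → γ :* r :* q := r :* (γ :* q)) refl γ (fromℕ r) (fromℕ q) ⟩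
        fromℕ r * (γ * fromℕ q)      ≤⟨ *-monoʳ-≤ (fromℕ-nonNeg r) γq≤n ⟩
        fromℕ r * fromℕ n            ≈⟨ ×1-homo-* r n ⟨
        fromℕ (r ℕ.* n)              ∎)

  -- Halving an approximant of x^(-1/r) divides its r-th power by 2^r, which compensates y ≤ 2^r x
  -- and leaves an approximant of y^(-1/r).
  ^ℝ-slow-decay : ∀ {x y} r → 1 ℕ.≤ r → 1# < x → x ≤ y → y ≤ 2# ^ r * x →
                  x ^ℝ (- (fromℕ r ⁻¹)) ≤ 2# * y ^ℝ (- (fromℕ r ⁻¹))
  ^ℝ-slow-decay {x} {y} r 1≤r 1<x x≤y y≤2ʳx = proj₂ (^ℝ-isLub 1<x 0<γ) λ {w} w∈ →
    ≤-respˡ-≈ (x*[x⁻¹*y]≈y 0<2 w) (*-monoʳ-≤ 0≤2 (proj₁ (^ℝ-isLub (<-≤-trans 1<x x≤y) 0<γ) (halve w∈)))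
    where
    γ : Carrier
    γ = fromℕ r ⁻¹
    0<r : 0# < fromℕ r
    0<r = 1≤x⇒0<x (1≤fromℕ 1≤r)
    0<γ : 0# < γ
    0<γ = 0<x⁻¹ 0<r
    0≤x : 0# ≤ x
    0≤x = <⇒≤ (1≤x⇒0<x (<⇒≤ 1<x))
    -- Raising to the power r and then extracting a q-th root brings any admissible exponent n/q to
    -- 1/r, because q ≤ n r.
    root : ∀ {w} → w ∈ BelowNegativePower x γ → w ^ r * x ≤ 1#
    root {w} (0≤w , n , q , 1≤q , γq≤n , le) =
      ^-cancelˡ-≤ q 1≤q (*-nonNeg (^-nonNeg r 0≤w) 0≤x) 0≤1 (begin
      (w ^ r * x) ^ q              ≈⟨ ^-distrib-* (w ^ r) x q ⟩
      (w ^ r) ^ q * x ^ q          ≤⟨ *-monoʳ-≤ (^-nonNeg q (^-nonNeg r 0≤w)) (^-monoʳ-≤ (<⇒≤ 1<x) q≤nr) ⟩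
      (w ^ r) ^ q * x ^ (n ℕ.* r)  ≈⟨ *-cong (^-^-comm w r q) (sym (^-assocʳ x n r)) ⟩
      (w ^ q) ^ r * (x ^ n) ^ r    ≈⟨ ^-distrib-* (w ^ q) (x ^ n) r ⟨
      (w ^ q * x ^ n) ^ r          ≤⟨ ^-monoˡ-≤ r (*-nonNeg (^-nonNeg q 0≤w) (^-nonNeg n 0≤x)) le ⟩
      1# ^ r                       ≈⟨ trans (1^n≈1 r) (sym (1^n≈1 q)) ⟩
      1# ^ q                       ∎)
      where
      q≤nr : q ℕ.≤ n ℕ.* r
      q≤nr = fromℕ-cancel-≤ (begin
        fromℕ q                  ≈⟨ x*[x⁻¹*y]≈y 0<r (fromℕ q) ⟨
        fromℕ r * (γ * fromℕ q)  ≤⟨ *-monoʳ-≤ (<⇒≤ 0<r) γq≤n ⟩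
        fromℕ r * fromℕ n        ≈⟨ *-comm (fromℕ r) (fromℕ n) ⟩
        fromℕ n * fromℕ r        ≈⟨ ×1-homo-* n r ⟨
        fromℕ (n ℕ.* r)          ∎)
    halve : ∀ {w} → w ∈ BelowNegativePower x γ → 2# ⁻¹ * w ∈ BelowNegativePower y γ
    halve {w} w∈@(0≤w , _) = 0≤u , 1 , r , 1≤r ,
      ≤-reflexive (trans (*-inverseˡ (≉0 0<r)) (sym (+-identityʳ 1#))) , (begin
      u ^ r * y ^ 1               ≈⟨ *-congˡ (*-identityʳ y) ⟩
      u ^ r * y                   ≤⟨ *-monoʳ-≤ (^-nonNeg r 0≤u) y≤2ʳx ⟩
      u ^ r * (2# ^ r * x)        ≈⟨ solve 3 (λ a b c → a :* (b :* c) := b :* a :* c) refl (u ^ r) (2# ^ r) x ⟩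
      2# ^ r * u ^ r * x          ≈⟨ *-congʳ (^-distrib-* 2# u r) ⟨
      (2# * u) ^ r * x            ≈⟨ *-congʳ (^-congˡ r (x*[x⁻¹*y]≈y 0<2 w)) ⟩
      w ^ r * x                   ≤⟨ root w∈ ⟩
      1#                          ∎)
      where
      u : Carrier
      u = 2# ⁻¹ * w
      0≤u : 0# ≤ u
      0≤u = *-nonNeg (<⇒≤ (0<x⁻¹ 0<2)) 0≤w

  -- If no element of `P` were positive, 0 would bound `P`, which rules out `⊤±` and keeps the
  -- supremum at most 0. Positive increase thus amounts to one positive exponent.
  0<sup±⇔ : ∀ {P : Pred Carrier 0ℓ} → ([ 0# ] <± sup± P) ⇔ (∃ λ γ → 0# < γ × P γ)
  0<sup±⇔ {P} = mk⇔ to from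
    where
    noPositive⇒bound : (∃ λ γ → 0# < γ × P γ) ⊎ IsUpperBound P 0#
    noPositive⇒bound with em {∃ λ γ → 0# < γ × P γ}
    ... | yes p = inj₁ p
    ... | no ¬p = inj₂ λ {γ} Pγ → ≮⇒≥ λ 0<γ → ¬p (γ , 0<γ , Pγ)
    to : [ 0# ] <± sup± P → ∃ λ γ → 0# < γ × P γ
    to 0<s with noPositive⇒bound | em {∃ P} | em {∃ (IsUpperBound P)}
    to 0<s | inj₁ p | _      | _     = p
    to (Supremum.[ () ]) | inj₂ b | no _ | _
    to 0<s | inj₂ b | yes _  | no ¬b = ⊥-elim (¬b (0# , b))
    to 0<s | inj₂ b | yes p  | yes u = ⊥-elim (≤⇒≯ (proj₂ (sup-isLub p u) b) (Extrema.[<]-injective _<_ 0<s))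
    from : (∃ λ γ → 0# < γ × P γ) → [ 0# ] <± sup± P
    from (γ , 0<γ , Pγ) with em {∃ P} | em {∃ (IsUpperBound P)}
    ... | no ¬p | _     = ⊥-elim (¬p (γ , Pγ))
    ... | yes _ | no _  = Extrema.[ 0# ]<⊤±
    ... | yes p | yes u = Extrema.[ <-≤-trans 0<γ (proj₁ (sup-isLub p u) Pγ) ]

  -- O-regular variation and positive increase of nondecreasing functions

  module Variation (f : Carrier → Carrier) (f-mono : Monotone f) (f-nonNeg : Nonnegative f)
                   (f-pos : EventuallyPositive f) where

    open Growth f f-mono f-nonNeg using (f-cong; doubling⇒dilate; expandsBy⇒expanding)

    orv⇔doubling : ORegularlyVarying f ⇔ Doubling f
    orv⇔doubling = mk⇔ to from
      where
      to : ORegularlyVarying f → Doubling f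
      to (_ , Θ) = =O⇒≲ (λ x _ → f-nonNeg _) (λ x _ → f-nonNeg x) (proj₁ (Θ 2# 0<2))
      from : Doubling f → ORegularlyVarying f
      from D = f-pos , λ c 0<c →
        ≲⇒=O (λ x _ → f-nonNeg _) (λ x _ → f-nonNeg x) (doubling⇒dilate D c) ,
        ≲⇒=O (λ x _ → f-nonNeg x) (λ x _ → f-nonNeg _) (undilate c 0<c (doubling⇒dilate D (c ⁻¹)))
        where
        -- The bound for the factor c⁻¹ is applied at c x.
        undilate : ∀ c → 0# < c → (λ x → f (c ⁻¹ * x)) ≲ f → f ≲ (λ x → f (c * x))
        undilate c 0<c (C , 1≤C , x₀ , _ , le) = C , 1≤C , eventually (c ⁻¹ * x₀) λ x c⁻¹x₀≤x → begin
          f x                  ≈⟨ f-cong (x⁻¹*[x*y]≈y 0<c x) ⟨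
          f (c ⁻¹ * (c * x))   ≤⟨ le (c * x) (≤-respˡ-≈ (x*[x⁻¹*y]≈y 0<c x₀) (*-monoʳ-≤ (<⇒≤ 0<c) c⁻¹x₀≤x)) ⟩
          C * f (c * x)        ∎

    -- Almost increase gives f(Λx) ≥ m Λ^γ f(x). With r ≥ 1/γ and N ≥ 2/m, the choice Λ = N^r has
    -- Λ^γ ≥ N and so a factor of at least 2. Starting from x ≥ 2 keeps x > 1, where x^(-γ) is known
    -- as a supremum.
    almostIncreasing⇒expanding : ∀ γ → 0# < γ → AlmostIncreasing (λ x → x ^ℝ (- γ) * f x) → Expanding f
    almostIncreasing⇒expanding γ 0<γ (m , x₀ , 0<m , _ , inc)
      with archimedean (γ ⁻¹) | archimedean (2# * m ⁻¹)
    ... | r , γ⁻¹<r | N′ , 2m⁻¹<N′ = expandsBy⇒expanding (N ^ r)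
            (eventually-zip bound (eventually x₀ λ _ x₀≤x → x₀≤x) (eventually 2# λ _ 2≤x → 2≤x))
      where
      N : Carrier
      N = fromℕ (suc N′)
      1≤N : 1# ≤ N
      1≤N = 1≤fromℕ {suc N′} (ℕ.s≤s ℕ.z≤n)
      2≤Nm : 2# ≤ N * m
      2≤Nm = begin
        2#                ≈⟨ x*[x⁻¹*y]≈y 0<m 2# ⟨
        m * (m ⁻¹ * 2#)   ≈⟨ solve 3 (λ m r t → m :* (r :* t) := t :* r :* m) refl m (m ⁻¹) 2# ⟩
        2# * m ⁻¹ * m     ≤⟨ *-monoˡ-≤ (<⇒≤ 0<m) (≤-trans (<⇒≤ 2m⁻¹<N′) (x≤y+x _ 0≤1)) ⟩
        N * m             ∎
      1≤γr : 1# ≤ γ * fromℕ r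
      1≤γr = ≤-respˡ-≈ (*-inverseʳ (≉0 0<γ)) (*-monoʳ-≤ (<⇒≤ 0<γ) (<⇒≤ γ⁻¹<r))
      bound : ∀ x → 1# ≤ x → x₀ ≤ x → 2# ≤ x → 2# * f x ≤ f (N ^ r * x)
      bound x 1≤x x₀≤x 2≤x = *-cancelˡ-≤ (^ℝ-pos 1<x 0<γ) (begin
        p * (2# * f x)           ≤⟨ *-monoʳ-≤ 0≤p (*-monoˡ-≤ (f-nonNeg x) 2≤Nm) ⟩
        p * (N * m * f x)
          ≈⟨ solve 4 (λ p N m q → p :* (N :* m :* q) := N :* (m :* (p :* q))) refl p N m (f x) ⟩
        N * (m * (p * f x))      ≤⟨ *-monoʳ-≤ (<⇒≤ (1≤x⇒0<x 1≤N)) (inc x z x₀≤x x≤z) ⟩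
        N * (z ^ℝ (- γ) * f z)   ≈⟨ *-assoc N (z ^ℝ (- γ)) (f z) ⟨
        N * z ^ℝ (- γ) * f z     ≤⟨ *-monoˡ-≤ (f-nonNeg z) (^ℝ-decay r N 1<x 0<γ 1≤γr 1≤N) ⟩
        p * f z                  ∎)
        where
        p z : Carrier
        p = x ^ℝ (- γ)
        z = N ^ r * x
        x≤z : x ≤ z
        x≤z = x≤c*x (1≤^ r 1≤N) (<⇒≤ (1≤x⇒0<x 1≤x))
        1<x : 1# < x
        1<x = <-≤-trans 1<2 2≤x
        0≤p : 0# ≤ p
        0≤p = <⇒≤ (^ℝ-pos 1<x 0<γ)

    -- For γ = 1/r with Λ ≤ 2^r the power x^γ at most doubles over [x , Λx], and the doubling of `f`
    -- over a full step makes up for this. Only one incomplete step loses a factor 2, whence m =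
    -- 1/2. The threshold x₀ + 1 ensures x > 1.
    expanding⇒almostIncreasing : Expanding f → ∃ λ γ → 0# < γ × AlmostIncreasing (λ x → x ^ℝ (- γ) * f x)
    expanding⇒almostIncreasing (Λ , 2≤Λ , x₀ , 1≤x₀ , 2f≤fΛ) with ∃2^n≥ Λ
    ... | r′ , Λ≤2^r′ = γ , 0<x⁻¹ 0<r , 2# ⁻¹ , x₀ + 1# , 0<x⁻¹ 0<2 , 1≤x⇒0<x (x≤y+x 1# (≤-trans 0≤1 1≤x₀)) ,
          λ x y x₁≤x x≤y → *-cancelˡ-≤ 0<2 (≤-respˡ-≈ (sym (x*[x⁻¹*y]≈y 0<2 _)) (h-increase x y x₁≤x x≤y))
      where
      r : ℕ
      r = suc r′
      γ : Carrier
      γ = fromℕ r ⁻¹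
      0<r : 0# < fromℕ r
      0<r = 1≤x⇒0<x (1≤fromℕ {r} (ℕ.s≤s ℕ.z≤n))
      1≤Λ : 1# ≤ Λ
      1≤Λ = ≤-trans 1≤2 2≤Λ
      0<Λ : 0# < Λ
      0<Λ = 1≤x⇒0<x 1≤Λ
      Λ≤2ʳ : Λ ≤ 2# ^ r
      Λ≤2ʳ = ≤-trans Λ≤2^r′ (^-monoʳ-≤ 1≤2 (ℕ.n≤1+n r′))
      h : Carrier → Carrier
      h x = x ^ℝ (- γ) * f x

      1<x-from : ∀ {x} → x₀ + 1# ≤ x → 1# < x
      1<x-from x₁≤x = <-≤-trans 1<2 (≤-trans (+-monoˡ-≤ 1# 1≤x₀) x₁≤x)

      0≤^ℝ : ∀ {x} → 1# < x → 0# ≤ x ^ℝ (- γ)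
      0≤^ℝ 1<x = <⇒≤ (^ℝ-pos 1<x (0<x⁻¹ 0<r))

      ^ℝ-near : ∀ x y → 1# < x → x ≤ y → y ≤ Λ * x → x ^ℝ (- γ) ≤ 2# * y ^ℝ (- γ)
      ^ℝ-near x y 1<x x≤y y≤Λx = ^ℝ-slow-decay r (ℕ.s≤s ℕ.z≤n) 1<x x≤y
        (≤-trans y≤Λx (*-monoˡ-≤ (<⇒≤ (1≤x⇒0<x (<⇒≤ 1<x))) Λ≤2ʳ))

      h-near : ∀ x y → x₀ + 1# ≤ x → x ≤ y → y ≤ Λ * x → h x ≤ 2# * h y
      h-near x y x₁≤x x≤y y≤Λx = begin
        x ^ℝ (- γ) * f x           ≤⟨ *-mono-≤ (*-nonNeg 0≤2 (0≤^ℝ (<-≤-trans (1<x-from x₁≤x) x≤y))) (f-nonNeg x)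
                                        (^ℝ-near x y (1<x-from x₁≤x) x≤y y≤Λx) (f-mono x≤y) ⟩
        2# * y ^ℝ (- γ) * f y      ≈⟨ *-assoc 2# (y ^ℝ (- γ)) (f y) ⟩
        2# * h y                   ∎

      -- Steps are removed at the upper end: from z = y/Λ to y the factor 2 lost in the power is
      -- cancelled by 2 f(z) ≤ f(y), so the constant 2 does not accumulate.
      h-steps : ∀ n x y → x₀ + 1# ≤ x → x ≤ y → y ≤ Λ ^ n * x → h x ≤ 2# * h y
      h-steps zero    x y x₁≤x x≤y y≤x =
        h-near x y x₁≤x x≤y (≤-trans y≤x (*-monoˡ-≤ (<⇒≤ (1≤x⇒0<x (<⇒≤ (1<x-from x₁≤x)))) 1≤Λ))
      h-steps (suc n) x y x₁≤x x≤y y≤ with total y (Λ * x)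
      ... | inj₁ y≤Λx = h-near x y x₁≤x x≤y y≤Λx
      ... | inj₂ Λx≤y = begin
        h x                           ≤⟨ h-steps n x z x₁≤x x≤z z≤Λⁿx ⟩
        2# * (z ^ℝ (- γ) * f z)
          ≤⟨ *-monoʳ-≤ 0≤2 (*-monoˡ-≤ (f-nonNeg z) (^ℝ-near z y 1<z z≤y (≤-reflexive (sym Λz≈y)))) ⟩
        2# * (2# * y ^ℝ (- γ) * f z)
          ≈⟨ solve 2 (λ p q → con 2 :* (con 2 :* p :* q) := con 2 :* (p :* (con 2 :* q))) refl (y ^ℝ (- γ)) (f z) ⟩
        2# * (y ^ℝ (- γ) * (2# * f z))
          ≤⟨ *-monoʳ-≤ 0≤2 (*-monoʳ-≤ (0≤^ℝ (<-≤-trans 1<z z≤y))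
               (≤-respʳ-≈ (f-cong Λz≈y) (2f≤fΛ z (≤-trans (x≤x+y x₀ 0≤1) (≤-trans x₁≤x x≤z))))) ⟩
        2# * h y                      ∎
        where
        z : Carrier
        z = Λ ⁻¹ * y
        Λz≈y : Λ * z ≈ y
        Λz≈y = x*[x⁻¹*y]≈y 0<Λ y
        x≤z : x ≤ z
        x≤z = *-cancelˡ-≤ 0<Λ (≤-respʳ-≈ (sym Λz≈y) Λx≤y)
        z≤Λⁿx : z ≤ Λ ^ n * x
        z≤Λⁿx = *-cancelˡ-≤ 0<Λ (≤-respˡ-≈ (sym Λz≈y) (≤-respʳ-≈ (*-assoc Λ (Λ ^ n) x) y≤))
        1<z : 1# < z
        1<z = <-≤-trans (1<x-from x₁≤x) x≤z
        z≤y : z ≤ y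
        z≤y = ≤-respʳ-≈ Λz≈y (x≤c*x 1≤Λ (<⇒≤ (1≤x⇒0<x (<⇒≤ 1<z))))

      h-increase : ∀ x y → x₀ + 1# ≤ x → x ≤ y → h x ≤ 2# * h y
      h-increase x y x₁≤x x≤y with ∃2^n≥ y
      ... | n , y≤2ⁿ = h-steps n x y x₁≤x x≤y (begin
        y             ≤⟨ y≤2ⁿ ⟩
        2# ^ n        ≤⟨ ^-monoˡ-≤ n 0≤2 2≤Λ ⟩
        Λ ^ n         ≈⟨ *-identityʳ _ ⟨
        Λ ^ n * 1#    ≤⟨ *-monoʳ-≤ (^-nonNeg n (<⇒≤ 0<Λ)) (<⇒≤ (1<x-from x₁≤x)) ⟩
        Λ ^ n * x     ∎)

    variation⇔regularGrowth : (ORegularlyVarying f × PositiveIncrease f) ⇔ RegularGrowth f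
    variation⇔regularGrowth = mk⇔
      (λ (orv , pi) → Equivalence.to orv⇔doubling orv ,
         let γ , 0<γ , inc = Equivalence.to 0<sup±⇔ pi in almostIncreasing⇒expanding γ 0<γ inc)
      (λ (D , G) → Equivalence.from orv⇔doubling D , Equivalence.from 0<sup±⇔ (expanding⇒almostIncreasing G))

  -- Counting functions

  module PowerComparison
    (f : Carrier → Carrier) (f-mono : Monotone f) (f-nonNeg : Nonnegative f)
    (g : Carrier → Carrier) (g-mono : Monotone g) (g-nonNeg : Nonnegative g)
    (h : ℕ) (1≤h : 1 ℕ.≤ h)
    (f^h≤g : ∀ x → f x ^ h ≤ g (fromℕ h * x)) (g≤f^h : ∀ x → g x ≤ f x ^ h)
    where

    private
      module f = Growth f f-mono f-nonNeg
      module g = Growth g g-mono g-nonNeg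
      H : Carrier
      H = fromℕ h
      1≤H : 1# ≤ H
      1≤H = 1≤fromℕ 1≤h
      0<H : 0# < H
      0<H = 1≤x⇒0<x 1≤H

    -- The value g(y) is bounded below through f at x = y/h; this shift by `H` is paid for by
    -- dilating `f` by 2H instead of 2.
    doubling-power : Doubling f → Doubling g
    doubling-power D with f.doubling⇒dilate D (2# * H)
    ... | C , 1≤C , x₀ , 1≤x₀ , le = C ^ h , 1≤^ h 1≤C , eventually (H * x₀) bound
      where
      bound : ∀ y → H * x₀ ≤ y → g (2# * y) ≤ C ^ h * g y
      bound y Hx₀≤y = begin
        g (2# * y)              ≤⟨ g≤f^h (2# * y) ⟩
        f (2# * y) ^ h          ≈⟨ ^-congˡ h (f.f-cong (*-congˡ Hx≈y)) ⟨
        f (2# * (H * x)) ^ h    ≈⟨ ^-congˡ h (f.f-cong (*-assoc 2# H x)) ⟨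
        f (2# * H * x) ^ h      ≤⟨ ^-monoˡ-≤ h (f-nonNeg _) (le x x₀≤x) ⟩
        (C * f x) ^ h           ≈⟨ ^-distrib-* C (f x) h ⟩
        C ^ h * f x ^ h         ≤⟨ *-monoʳ-≤ (<⇒≤ (1≤x⇒0<x (1≤^ h 1≤C))) (f^h≤g x) ⟩
        C ^ h * g (H * x)       ≈⟨ *-congˡ (g.f-cong Hx≈y) ⟩
        C ^ h * g y             ∎
        where
        x : Carrier
        x = H ⁻¹ * y
        Hx≈y : H * x ≈ y
        Hx≈y = x*[x⁻¹*y]≈y 0<H y
        x₀≤x : x₀ ≤ x
        x₀≤x = *-cancelˡ-≤ 0<H (≤-respʳ-≈ (sym Hx≈y) Hx₀≤y)

    -- The dilation by h is absorbed into that of `g`, and enlarging C to C^h makes the constant an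
    -- h-th power, so that the root can be taken.
    doubling-root : Doubling g → Doubling f
    doubling-root D with g.doubling⇒dilate D (H * 2#)
    ... | C , 1≤C , le = C , 1≤C , eventually-map bound le
      where
      0≤C : 0# ≤ C
      0≤C = <⇒≤ (1≤x⇒0<x 1≤C)
      bound : ∀ x → 1# ≤ x → g (H * 2# * x) ≤ C * g x → f (2# * x) ≤ C * f x
      bound x 1≤x le = ^-cancelˡ-≤ h 1≤h (f-nonNeg _) (*-nonNeg 0≤C (f-nonNeg x)) (begin
        f (2# * x) ^ h       ≤⟨ f^h≤g (2# * x) ⟩
        g (H * (2# * x))     ≈⟨ g.f-cong (*-assoc H 2# x) ⟨
        g (H * 2# * x)       ≤⟨ le ⟩
        C * g x              ≤⟨ *-mono-≤ (^-nonNeg h 0≤C) (g-nonNeg x) (x≤x^n 1≤C 1≤h) (g≤f^h x) ⟩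
        C ^ h * f x ^ h      ≈⟨ ^-distrib-* C (f x) h ⟨
        (C * f x) ^ h        ∎)

    expanding-power : Expanding f → Expanding g
    expanding-power (Λ , _ , le) = g.expandsBy⇒expanding (H * Λ) (eventually-map bound le)
      where
      bound : ∀ x → 1# ≤ x → 2# * f x ≤ f (Λ * x) → 2# * g x ≤ g (H * Λ * x)
      bound x 1≤x le = begin
        2# * g x             ≤⟨ *-mono-≤ (^-nonNeg h 0≤2) (g-nonNeg x) (x≤x^n 1≤2 1≤h) (g≤f^h x) ⟩
        2# ^ h * f x ^ h     ≈⟨ ^-distrib-* 2# (f x) h ⟨
        (2# * f x) ^ h       ≤⟨ ^-monoˡ-≤ h (*-nonNeg 0≤2 (f-nonNeg x)) le ⟩
        f (Λ * x) ^ h        ≤⟨ f^h≤g (Λ * x) ⟩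
        g (H * (Λ * x))      ≈⟨ g.f-cong (*-assoc H Λ x) ⟨
        g (H * Λ * x)        ∎

    -- An h-th root would shrink a gain of 2 to 2^(1/h), so the expansion of `g` is iterated h times
    -- to gain 2^h.
    expanding-root : Expanding g → Expanding f
    expanding-root (Λ , 2≤Λ , G@(x₀ , 1≤x₀ , _)) = f.expandsBy⇒expanding (Λ ^ h * H) (x₀ , 1≤x₀ , bound)
      where
      bound : ∀ x → x₀ ≤ x → 2# * f x ≤ f (Λ ^ h * H * x)
      bound x x₀≤x = ^-cancelˡ-≤ h 1≤h (*-nonNeg 0≤2 (f-nonNeg x)) (f-nonNeg _) (begin
        (2# * f x) ^ h           ≈⟨ ^-distrib-* 2# (f x) h ⟩
        2# ^ h * f x ^ h         ≤⟨ *-monoʳ-≤ (^-nonNeg h 0≤2) (f^h≤g x) ⟩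
        2# ^ h * g (H * x)       ≤⟨ g.expand-iterate (≤-trans 1≤2 2≤Λ) G h (H * x)
                                      (≤-trans x₀≤x (x≤c*x 1≤H (<⇒≤ (1≤x⇒0<x (≤-trans 1≤x₀ x₀≤x))))) ⟩
        g (Λ ^ h * (H * x))      ≈⟨ g.f-cong (*-assoc (Λ ^ h) H x) ⟨
        g (Λ ^ h * H * x)        ≤⟨ g≤f^h _ ⟩
        f (Λ ^ h * H * x) ^ h    ∎)

    regularGrowth⇔ : RegularGrowth f ⇔ RegularGrowth g
    regularGrowth⇔ = mk⇔ (λ (D , G) → doubling-power D , expanding-power G)
                         (λ (D , G) → doubling-root D , expanding-root G)

  fromℕ-≤-< : ∀ {k x} N → fromℕ k ≤ x → x < fromℕ N → k ℕ.< N
  fromℕ-≤-< N k≤x x<N = ℕ.≰⇒> λ N≤k → ≤⇒≯ (≤-trans (fromℕ-mono-≤ N≤k) k≤x) x<N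

  ∣fromℕ∣≈ : ∀ n → ∣ fromℕ n ∣ ≈ fromℕ n
  ∣fromℕ∣≈ n = ∣x∣≈x (fromℕ-nonNeg n)

  fromℕ-sum-≤ : ∀ {h x} {v : Vec ℕ h} → All (λ k → fromℕ k ≤ x) v → fromℕ (Vec.sum v) ≤ fromℕ h * x
  fromℕ-sum-≤ {x = x} All.[] = ≤-reflexive (sym (zeroˡ x))
  fromℕ-sum-≤ {suc h} {x} {k Vec.∷ v} (k≤x All.∷ v≤x) = begin
    fromℕ (k ℕ.+ Vec.sum v)        ≈⟨ ×-homo-+ 1# k (Vec.sum v) ⟩
    fromℕ k + fromℕ (Vec.sum v)    ≤⟨ +-mono-≤ k≤x (fromℕ-sum-≤ v≤x) ⟩
    x + fromℕ h * x                ≈⟨ solve 2 (λ x h → x :+ h :* x := (con 1 :+ h) :* x) refl x (fromℕ h) ⟩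
    (1# + fromℕ h) * x             ∎

  module Counting (𝒜 : Pred ℕ 0ℓ) where

    -- `counting 𝒜 x` unfolds to `fromℕ` of the length of this list, so the count can be treated as
    -- a list; `tuples` does the same for `countingTuples`.
    elements : Carrier → List ℕ
    elements x = filter (λ k → em {k ∈ 𝒜 × fromℕ k ≤ x}) (upTo (proj₁ (archimedean x)))

    tuples : ∀ h → Carrier → List (Vec ℕ h)
    tuples h x = filter (λ k → em {All 𝒜 k × fromℕ (Vec.sum k) ≤ x}) (boxes h (proj₁ (archimedean x)))

    ∈-elements⁺ : ∀ {x k} → k ∈ 𝒜 → fromℕ k ≤ x → k List.∈ elements x
    ∈-elements⁺ {x} k∈𝒜 k≤x =
      ∈-filter⁺ (λ k → em {k ∈ 𝒜 × fromℕ k ≤ x}) (∈-upTo⁺ (fromℕ-≤-< N k≤x x<N)) (k∈𝒜 , k≤x)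
      where
      N = proj₁ (archimedean x)
      x<N = proj₂ (archimedean x)

    ∈-elements⁻ : ∀ {x k} → k List.∈ elements x → k ∈ 𝒜 × fromℕ k ≤ x
    ∈-elements⁻ {x} k∈ = proj₂ (∈-filter⁻ (λ k → em) {xs = upTo (proj₁ (archimedean x))} k∈)

    ∈-tuples⁺ : ∀ {h x} {v : Vec ℕ h} → All 𝒜 v → fromℕ (Vec.sum v) ≤ x → v List.∈ tuples h x
    ∈-tuples⁺ {h} {x} {v} v∈𝒜 v≤x = ∈-filter⁺ (λ v → em)
      (≡.subst (v List.∈_) (≡.sym (boxes≡vectors h _)) (∈-vectors⁺ _
        (VecAll.map (λ k≤ → ∈-upTo⁺ (fromℕ-≤-< _ (≤-trans (fromℕ-mono-≤ k≤) v≤x) (proj₂ (archimedean x))))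
                    (all≤sum v))))
      (v∈𝒜 , v≤x)

    ∈-tuples⁻ : ∀ {h x} {v : Vec ℕ h} → v List.∈ tuples h x → All 𝒜 v × fromℕ (Vec.sum v) ≤ x
    ∈-tuples⁻ {h} {x} v∈ = proj₂ (∈-filter⁻ (λ v → em) {xs = boxes h (proj₁ (archimedean x))} v∈)

    elements-unique : ∀ x → Unique (elements x)
    elements-unique x = Unique.filter⁺ (λ k → em) (Unique.upTo⁺ (proj₁ (archimedean x)))

    tuples-unique : ∀ h x → Unique (tuples h x)
    tuples-unique h x = Unique.filter⁺ (λ v → em)
      (≡.subst Unique (≡.sym (boxes≡vectors h _)) (vectors-unique _ h (Unique.upTo⁺ _)))

    counting-mono : Monotone (counting 𝒜)
    counting-mono {x} x≤y = fromℕ-mono-≤ (Unique-⊆⇒length-≤ (elements-unique x) λ k∈ →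
      let k∈𝒜 , k≤x = ∈-elements⁻ k∈ in ∈-elements⁺ k∈𝒜 (≤-trans k≤x x≤y))

    countingTuples-mono : ∀ h → Monotone (countingTuples 𝒜 h)
    countingTuples-mono h {x} x≤y = fromℕ-mono-≤ (Unique-⊆⇒length-≤ (tuples-unique h x) λ v∈ →
      let v∈𝒜 , v≤x = ∈-tuples⁻ v∈ in ∈-tuples⁺ v∈𝒜 (≤-trans v≤x x≤y))

    length-vectors-elements : ∀ h x → fromℕ (length (vectors h (elements x))) ≈ counting 𝒜 x ^ h
    length-vectors-elements h x = trans (reflexive (≡.cong fromℕ (length-vectors (elements x) h)))
                                        (fromℕ-^ (length (elements x)) h)

    counting^h≤countingTuples : ∀ h x → counting 𝒜 x ^ h ≤ countingTuples 𝒜 h (fromℕ h * x)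
    counting^h≤countingTuples h x = ≤-respˡ-≈ (length-vectors-elements h x)
      (fromℕ-mono-≤ (Unique-⊆⇒length-≤ (vectors-unique (elements x) h (elements-unique x)) λ v∈ →
        let v∈′ = ∈-vectors⁻ (elements x) v∈ in
        ∈-tuples⁺ (VecAll.map (λ k∈ → proj₁ (∈-elements⁻ k∈)) v∈′)
                  (fromℕ-sum-≤ (VecAll.map (λ k∈ → proj₂ (∈-elements⁻ k∈)) v∈′))))

    countingTuples≤counting^h : ∀ h x → countingTuples 𝒜 h x ≤ counting 𝒜 x ^ h
    countingTuples≤counting^h h x = ≤-respʳ-≈ (length-vectors-elements h x)
      (fromℕ-mono-≤ (Unique-⊆⇒length-≤ (tuples-unique h x) λ {v} v∈ →
        let v∈𝒜 , v≤x = ∈-tuples⁻ v∈ in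
        ∈-vectors⁺ (elements x) (VecAll.map (λ (k∈𝒜 , k≤) → ∈-elements⁺ k∈𝒜 (≤-trans (fromℕ-mono-≤ k≤) v≤x))
                                            (VecAll.zip (v∈𝒜 , all≤sum v)))))

  -- The enumeration as inverse of the counting function

  module Inverse (𝒜 : Pred ℕ 0ℓ) (a : ℕ → ℕ) (enum : Enumerates a 𝒜) where
    open Counting 𝒜
    open Enumeration enum
    open Enumerates enum

    count : Carrier → ℕ
    count x = length (elements x)

    -- The terms a_0, ..., a_m are m + 1 distinct elements up to x.
    a[m]≤⇒m<count : ∀ {m x} → fromℕ (a m) ≤ x → m ℕ.< count x
    a[m]≤⇒m<count {m} {x} am≤x = ℕ.≤-trans (ℕ.≤-reflexive (≡.sym length≡))
      (Unique-⊆⇒length-≤ (Unique.map⁺ a-injective (Unique.upTo⁺ (suc m))) λ k∈ →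
        let n , n∈ , k≡ = ∈-map⁻ a k∈ in
        ∈-elements⁺ (Equivalence.from (range _) (n , ≡.sym k≡))
          (≤-trans (fromℕ-mono-≤ (≡.subst (ℕ._≤ a m) (≡.sym k≡) (a-mono (ℕ.s≤s⁻¹ (∈-upTo⁻ n∈))))) am≤x))
      where
      length≡ : length (map a (upTo (suc m))) ≡ suc m
      length≡ = ≡.trans (List.length-map a (upTo (suc m))) (List.length-upTo (suc m))

    -- If x < a_m, all elements up to x are among a_0, ..., a_(m-1), so there are at most m of them.
    m<count⇒a[m]≤ : ∀ {m x} → m ℕ.< count x → fromℕ (a m) ≤ x
    m<count⇒a[m]≤ {m} {x} m<count = ≮⇒≥ λ x<am → ℕ.<⇒≱ m<count (ℕ.≤-trans
      (Unique-⊆⇒length-≤ (elements-unique x) (below x<am))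
      (ℕ.≤-reflexive (≡.trans (List.length-map a (upTo m)) (List.length-upTo m))))
      where
      below : x < fromℕ (a m) → ∀ {k} → k List.∈ elements x → k List.∈ map a (upTo m)
      below x<am k∈ with ∈-elements⁻ k∈
      ... | k∈𝒜 , k≤x with Equivalence.to (range _) k∈𝒜
      ...   | n , ≡.refl = ∈-map⁺ a (∈-upTo⁺ (ℕ.≰⇒> λ m≤n → ≤⇒≯ (≤-trans (fromℕ-mono-≤ (a-mono m≤n)) k≤x) x<am))

    counting-eventuallyPositive : EventuallyPositive (counting 𝒜)
    counting-eventuallyPositive = fromℕ (a 0) , λ x a₀≤x → 1≤x⇒0<x (1≤fromℕ (a[m]≤⇒m<count a₀≤x))

    DoublingTerms : Set
    DoublingTerms = (λ n → fromℕ (a (2 ℕ.* n))) =Oₛ (λ n → fromℕ (a n))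

    -- At a_n the count is at least n + 1, so at Λ a_n it is at least 2n + 2 and exceeds 2n. As a_n
    -- ≥ n, an `n₀` beyond x₀ puts a_n past the threshold.
    expanding⇒doublingTerms : Expanding (counting 𝒜) → DoublingTerms
    expanding⇒doublingTerms (Λ , 2≤Λ , x₀ , _ , le) with archimedean x₀
    ... | n₀ , x₀<n₀ = Λ , n₀ , 1≤x⇒0<x (≤-trans 1≤2 2≤Λ) , λ n n₀≤n → begin
      ∣ fromℕ (a (2 ℕ.* n)) ∣     ≈⟨ ∣fromℕ∣≈ (a (2 ℕ.* n)) ⟩
      fromℕ (a (2 ℕ.* n))         ≤⟨ m<count⇒a[m]≤ (2n<count n n₀≤n) ⟩
      Λ * fromℕ (a n)             ≈⟨ *-congˡ (∣fromℕ∣≈ (a n)) ⟨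
      Λ * ∣ fromℕ (a n) ∣         ∎
      where
      2n<count : ∀ n → n₀ ℕ.≤ n → 2 ℕ.* n ℕ.< count (Λ * fromℕ (a n))
      2n<count n n₀≤n = ℕ.<-≤-trans (ℕ.*-monoʳ-< 2 (a[m]≤⇒m<count ≤-refl)) (fromℕ-cancel-≤ (begin
        fromℕ (2 ℕ.* count (fromℕ (a n)))     ≈⟨ ×1-homo-* 2 (count (fromℕ (a n))) ⟩
        fromℕ 2 * counting 𝒜 (fromℕ (a n))    ≈⟨ *-congʳ fromℕ-2 ⟩
        2# * counting 𝒜 (fromℕ (a n))
          ≤⟨ le (fromℕ (a n)) (≤-trans (<⇒≤ x₀<n₀) (fromℕ-mono-≤ (ℕ.≤-trans n₀≤n (n≤a[n] n)))) ⟩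
        counting 𝒜 (Λ * fromℕ (a n))          ∎))

    doublingTerms⇒expanding : DoublingTerms → Expanding (counting 𝒜)
    doublingTerms⇒expanding (C , n₀ , 0<C , le) =
      Growth.expandsBy⇒expanding (counting 𝒜) counting-mono (λ x → fromℕ-nonNeg (count x)) (C * C)
        -- From a_(n₀+1) on the count is at least n₀ + 2, so the last index counted is at least n₀ +
        -- 1: within reach of the hypothesis, and not 0.
        (eventually (fromℕ (a (suc n₀))) bound)
      where
      le′ : ∀ n → n₀ ℕ.≤ n → fromℕ (a (2 ℕ.* n)) ≤ C * fromℕ (a n)
      le′ n n₀≤n = ≤-respˡ-≈ (∣fromℕ∣≈ (a (2 ℕ.* n))) (≤-respʳ-≈ (*-congˡ (∣fromℕ∣≈ (a n))) (le n n₀≤n))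

      -- With n + 1 elements up to x, doubling the count calls for a_(2n+1) ≤ C² x. One use of the
      -- hypothesis reaches only a_(2n), one term short; a second reaches a_(4n), and 2n + 1 ≤ 4n
      -- because n ≥ 1.
      2count≤ : ∀ x c → suc n₀ ℕ.< c → c ≡ count x → 2 ℕ.* c ℕ.≤ count (C * C * x)
      2count≤ x (suc n) n₀<n c≡ = ≡.subst (ℕ._≤ count (C * C * x)) (≡.sym (ℕ.*-suc 2 n)) (a[m]≤⇒m<count (begin
        fromℕ (a (suc (2 ℕ.* n)))             ≤⟨ fromℕ-mono-≤ (a-mono 1+2n≤4n) ⟩
        fromℕ (a (2 ℕ.* (2 ℕ.* n)))           ≤⟨ le′ (2 ℕ.* n) (ℕ.≤-trans n₀≤n (ℕ.m≤n*m n 2)) ⟩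
        C * fromℕ (a (2 ℕ.* n))               ≤⟨ *-monoʳ-≤ (<⇒≤ 0<C) (le′ n n₀≤n) ⟩
        C * (C * fromℕ (a n))
          ≤⟨ *-monoʳ-≤ (<⇒≤ 0<C) (*-monoʳ-≤ (<⇒≤ 0<C) (m<count⇒a[m]≤ (ℕ.≤-reflexive c≡))) ⟩
        C * (C * x)                           ≈⟨ *-assoc C C x ⟨
        C * C * x                             ∎))
        where
        1+n₀≤n : suc n₀ ℕ.≤ n
        1+n₀≤n = ℕ.s≤s⁻¹ n₀<n
        n₀≤n : n₀ ℕ.≤ n
        n₀≤n = ℕ.≤-trans (ℕ.n≤1+n n₀) 1+n₀≤n
        1+2n≤4n : suc (2 ℕ.* n) ℕ.≤ 2 ℕ.* (2 ℕ.* n)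
        1+2n≤4n = ℕ.m<m+n (2 ℕ.* n) (ℕ.≤-trans (ℕ.≤-trans (ℕ.s≤s ℕ.z≤n) 1+n₀≤n)
                    (ℕ.≤-trans (ℕ.m≤n*m n 2) (ℕ.m≤n*m (2 ℕ.* n) 1)))

      bound : ∀ x → fromℕ (a (suc n₀)) ≤ x → 2# * counting 𝒜 x ≤ counting 𝒜 (C * C * x)
      bound x le = begin
        2# * counting 𝒜 x              ≈⟨ *-congʳ fromℕ-2 ⟨
        fromℕ 2 * counting 𝒜 x         ≈⟨ ×1-homo-* 2 (count x) ⟨
        fromℕ (2 ℕ.* count x)          ≤⟨ fromℕ-mono-≤ (2count≤ x (count x) (a[m]≤⇒m<count le) ≡.refl) ⟩
        counting 𝒜 (C * C * x)         ∎

  -- The conditions reduced to regular growth of the counting function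

  module Equivalences (𝒜 : Pred ℕ 0ℓ) (a : ℕ → ℕ) (enum : Enumerates a 𝒜) where

    open Counting 𝒜
    open Inverse 𝒜 a enum

    A : Carrier → Carrier
    A = counting 𝒜

    A-nonNeg : Nonnegative A
    A-nonNeg x = fromℕ-nonNeg (length (elements x))

    A-cong : ∀ {x y} → x ≈ y → A x ≈ A y
    A-cong = Growth.f-cong A counting-mono A-nonNeg

    i⇔ : (ORegularlyVarying A × PositiveIncrease A) ⇔ RegularGrowth A
    i⇔ = Variation.variation⇔regularGrowth A counting-mono A-nonNeg counting-eventuallyPositive

    ii⇔ : LogIntegralΘ A ⇔ RegularGrowth A
    ii⇔ = Growth.logIntegralΘ⇔regularGrowth A counting-mono A-nonNeg

    iii⇔ : ((λ x → A (fromℕ 2 * x)) =O A × DoublingTerms) ⇔ RegularGrowth A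
    iii⇔ = mk⇔ to from
      where
      A2x≈ : ∀ x → A (2# * x) ≈ A (fromℕ 2 * x)
      A2x≈ x = A-cong (*-congʳ (sym fromℕ-2))
      to : (λ x → A (fromℕ 2 * x)) =O A × DoublingTerms → RegularGrowth A
      to (O , T) with =O⇒≲ (λ x _ → A-nonNeg _) (λ x _ → A-nonNeg x) O
      ... | C , 1≤C , le =
        (C , 1≤C , eventually-map (λ x _ → ≤-respˡ-≈ (sym (A2x≈ x))) le) , doublingTerms⇒expanding T
      from : RegularGrowth A → (λ x → A (fromℕ 2 * x)) =O A × DoublingTerms
      from ((C , 1≤C , le) , G) =
        ≲⇒=O (λ x _ → A-nonNeg _) (λ x _ → A-nonNeg x) (C , 1≤C , eventually-map (λ x _ → ≤-respˡ-≈ (A2x≈ x)) le) ,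
        expanding⇒doublingTerms G

    -- Each `h` is tied to the growth of `A` alone, which therefore mediates between one value of
    -- `h` and all others.
    iv⇔ : ∀ h → 1 ℕ.≤ h → LogIntegralΘ (countingTuples 𝒜 h) ⇔ RegularGrowth A
    iv⇔ h 1≤h = ⇔-trans (Growth.logIntegralΘ⇔regularGrowth s s-mono s-nonNeg) (⇔-sym
      (PowerComparison.regularGrowth⇔ A counting-mono A-nonNeg s s-mono s-nonNeg h 1≤h
        (counting^h≤countingTuples h) (countingTuples≤counting^h h)))
      where
      s : Carrier → Carrier
      s = countingTuples 𝒜 h
      s-mono : Monotone s
      s-mono = countingTuples-mono h
      s-nonNeg : Nonnegative s
      s-nonNeg x = fromℕ-nonNeg (length (tuples h x))

propositionA8 :
    (em : ExcludedMiddle 0ℓ) (ℝ : CompleteOrderedField) →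
    let open CompleteOrderedField ℝ using (Carrier) renaming (_*_ to _*ᴿ_)
        open Analysis em ℝ
    in
    (𝒜 : Pred ℕ 0ℓ) (a : ℕ → ℕ) → Enumerates a 𝒜 →
    let A : Carrier → Carrier
        A = counting 𝒜
        s : ℕ → Carrier → Carrier
        s = countingTuples 𝒜
        i : Set
        i = ORegularlyVarying A × PositiveIncrease A
        ii : Set
        ii = LogIntegralΘ A
        iii : Set
        iii = ((λ x → A (fromℕ 2 *ᴿ x)) =O A) × ((λ n → fromℕ (a (2 ℕ.* n))) =Oₛ (λ n → fromℕ (a n)))
        iv-some : Set
        iv-some = ∃ λ h → 1 ℕ.≤ h × LogIntegralΘ (s h)
        iv-all : Set
        iv-all = ∀ h → 1 ℕ.≤ h → LogIntegralΘ (s h)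
    in
    (i ⇔ ii) × (ii ⇔ iii) × (iii ⇔ iv-some) × (iv-some ⇔ iv-all)
propositionA8 em ℝ 𝒜 a enum =
  ⇔-trans i⇔ (⇔-sym ii⇔) , ⇔-trans ii⇔ (⇔-sym iii⇔) , ⇔-trans iii⇔ (⇔-sym iv-some⇔) ,
  mk⇔ (λ some h 1≤h → Equivalence.from (iv⇔ h 1≤h) (Equivalence.to iv-some⇔ some))
      (λ all → 1 , ℕ.≤-refl , all 1 ℕ.≤-refl)
  where
  open RealAnalysis em ℝ
  open Equivalences 𝒜 a enum
  iv-some⇔ = mk⇔ {B = RegularGrowth A} (λ (h , 1≤h , L) → Equivalence.to (iv⇔ h 1≤h) L)
                 (λ R → 1 , ℕ.≤-refl , Equivalence.from (iv⇔ 1 ℕ.≤-refl) R)
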